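{- Let $\ell$ and $m$ be positive integers such that $2 \leq \ell < m$. Let $\mathcal{A} = (A_1, \ldots, A_m)$ be a sequence of subsets of $\mathbb{Z}_p$, where $p$ is prime and $|A_i| \geq 2$ for each $i \in [1,m]$. Let $A = A_1 \cup \cdots \cup A_m$, $\mu(a) = \min\left(\ell, \sum_{j=1}^m \chi_{A_j}(a)\right)$ for $a\in A$, and $M = \{a \in A : \mu(a) = \ell\}$. Suppose that $|\Sigma^{\ell}(\mathcal{A})| < p-1$ if $\ell = 2$ and $|\Sigma^{\ell}(\mathcal{A})| < p$ if $\ell \geq 3$. Then \[ |\Sigma^{\ell}(\mathcal{A})| = \sum_{a \in A} \mu(a) - \ell + 1 \] if and only if $\mathcal{A}$ is an $(\ell, d)$-minimizing sequence of sets. Furthermore, if the bound on $|\Sigma^{\ell}(\mathcal{A})|$ (i.e. $<p-1$ for $\ell=2$, $<p$ for $\ell\ge 3$) and the equality $|\Sigma^{\ell}(\mathcal{A})| = \sum_{a \in A} \mu(a) - \ell + 1$ both hold, then: (1) if $\ell = 2$, then $A_1 \cup M, \ldots, A_m \cup M$ are arithmetic progressions; (2) if $\ell \geq 3$, then the sets $A, A_1 \cup M, \ldots, A_m \cup M$ are arithmetic progressions with the same common difference $d$; (3) furthermore, if $\ell \geq 3$, then $A$ is an arithmetic progression with common difference $d$.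
   Context: Notation: $\chi_X(a)=1$ if $a\in X$ and $0$ otherwise; $[x,y]=\{n\in\mathbb{Z}:x\le n\le y\}$. The generalized sumset is $\Sigma^{\ell}(\mathcal{A}) = \{a_{i_1} + \cdots + a_{i_\ell} : a_{i_j} \in A_{i_j},\ 1 \leq i_1 < \cdots < i_\ell \leq m\}$. The sequence $\mathcal{A}$ is an $(\ell, d)$-minimizing sequence of sets if there exist sets $B_1, \ldots, B_\ell \subseteq A$ such that: (1) $|B_i| \geq 2$ for each $i$; (2) there is $d\in\mathbb{Z}_p$, $d\neq 0$, such that each $B_i$ is an arithmetic progression with common difference $d$; (3) $\mu(a) = \sum_{j=1}^{\ell} \chi_{B_j}(a)$ for every $a \in A$; (4) $B_1 + \cdots + B_\ell = \Sigma^{\ell}(\mathcal{A})$. -}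

module Defs where

open import Data.Bool using (Bool; true; false; if_then_else_; _∧_)
open import Data.Nat using (ℕ; zero; suc; _+_; _*_; _∸_; _≤_; _<_; NonZero; _⊓_; _≡ᵇ_)
open import Data.Nat.DivMod using (_mod_)
open import Data.Fin using (Fin; toℕ) renaming (_<_ to _<ᶠ_)
open import Data.Fin.Subset using (Subset; _∈_; _∪_; ⋃; ∣_∣)
open import Data.Vec using (lookup; tabulate)
import Data.List as List
open import Data.Product using (Σ; ∃; _×_)
open import Function.Bundles using (_⇔_)
open import Relation.Binary.PropositionalEquality using (_≡_; _≢_)

-- ℤ_p is represented by Fin p (residues 0..p-1), arithmetic mod p.
module _ (p : ℕ) .{{_ : NonZero p}} where

  _+ₚ_ : Fin p → Fin p → Fin p
  x +ₚ y = (toℕ x + toℕ y) mod p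

  apElem : Fin p → Fin p → ℕ → Fin p
  apElem a d i = (toℕ a + i * toℕ d) mod p

  sumₚ : ∀ {n} → (Fin n → Fin p) → Fin p
  sumₚ {zero} g = 0 mod p
  sumₚ {suc n} g = g Fin.zero +ₚ sumₚ (λ j → g (Fin.suc j))
    where import Data.Fin as Fin

  IsAPWith : Fin p → Subset p → Set
  IsAPWith d B = ∃ λ (a : Fin p) → ∃ λ (k : ℕ) →
    ∀ x → (x ∈ B) ⇔ (∃ λ (i : ℕ) → (i < k) × (x ≡ apElem a d i))

  IsAP : Subset p → Set
  IsAP B = ∃ λ (d : Fin p) → (toℕ d ≢ 0) × IsAPWith d B

  InSumset : (ℓ m : ℕ) → (Fin m → Subset p) → Fin p → Set
  InSumset ℓ m A x =
    ∃ λ (f : Fin ℓ → Fin m) → (∀ i j → i <ᶠ j → f i <ᶠ f j) ×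
    ∃ λ (g : Fin ℓ → Fin p) → (∀ j → g j ∈ A (f j)) × (sumₚ g ≡ x)

  InSum : (ℓ : ℕ) → (Fin ℓ → Subset p) → Fin p → Set
  InSum ℓ B x = ∃ λ (g : Fin ℓ → Fin p) → (∀ j → g j ∈ B j) × (sumₚ g ≡ x)

∑ : ∀ {n} → (Fin n → ℕ) → ℕ
∑ {zero} f = 0
∑ {suc n} f = f Fin.zero + ∑ (λ j → f (Fin.suc j))
  where import Data.Fin as Fin

χ : ∀ {n} → Subset n → Fin n → ℕ
χ X a = if lookup X a then 1 else 0

module _ (p : ℕ) (m : ℕ) (A : Fin m → Subset p) where

  unionA : Subset p
  unionA = ⋃ (List.tabulate A)

  μ : ℕ → Fin p → ℕ
  μ ℓ a = ℓ ⊓ ∑ (λ j → χ (A j) a)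

  sumμ : ℕ → ℕ
  sumμ ℓ = ∑ (λ a → if lookup unionA a then μ ℓ a else 0)

  Mset : ℕ → Subset p
  Mset ℓ = tabulate (λ a → lookup unionA a ∧ (μ ℓ a ≡ᵇ ℓ))

IsMinimizingWith : (p : ℕ) .{{_ : NonZero p}} (ℓ m : ℕ) → (Fin m → Subset p) → Fin p → Set
IsMinimizingWith p ℓ m A d =
  (toℕ d ≢ 0) ×
  ∃ λ (B : Fin ℓ → Subset p) →
    (∀ i x → x ∈ B i → x ∈ unionA p m A) ×
    (∀ i → 2 ≤ ∣ B i ∣) ×
    (∀ i → IsAPWith p d (B i)) ×
    (∀ a → a ∈ unionA p m A → μ p m A ℓ a ≡ ∑ (λ j → χ (B j) a)) ×
    (∀ x → InSum p ℓ B x ⇔ InSumset p ℓ m A x)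

IsMinimizing : (p : ℕ) .{{_ : NonZero p}} (ℓ m : ℕ) → (Fin m → Subset p) → Set
IsMinimizing p ℓ m A = ∃ λ (d : Fin p) → IsMinimizingWith p ℓ m A d

{-# OPTIONS --safe #-}
module Submission where

-- Replacing two members X, Y of a family by X ∪ Y and X ∩ Y keeps all multiplicities and can only
-- shrink Σ^ℓ.  Pushing one member in this way through all the others leaves a remainder contained
-- in every other member; if the family has more than ℓ members, this remainder can be dropped
-- without changing μ.  So a family shrinks to ℓ sets of size at least 2.  For these,
-- Cauchy–Davenport bounds |Σ^ℓ|, and by Vosper's theorem equality forces progressions with a common
-- difference.  If A_i is visited last, it ends up as A_i ∪ M.  For ℓ ≥ 3 the reductions of a family
-- of ℓ + 1 sets along suitable orders share a member, hence have the same difference d.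
-- These reductions contain the union of any two members, so A has at most one point x ∈ A with
-- x − d ∉ A, and is a progression too.

open import Defs
open import Algebra.Bundles using (AbelianGroup)
import Algebra.Properties.AbelianGroup as AbelianGroupProperties
import Algebra.Properties.CommutativeSemigroup as CommutativeSemigroupProperties
open import Data.Bool using (true; false; if_then_else_; _∧_; _∨_)
open import Data.Bool.Properties using (T-≡; T-∧)
open import Data.Empty using (⊥-elim) renaming (⊥ to Absurd)
open import Data.Fin using (Fin; zero; suc; toℕ; fromℕ<) renaming (_<_ to _<ᶠ_)
open import Data.Fin.Properties using (any?; all?; toℕ-injective; toℕ<n; toℕ-fromℕ<)
import Data.Fin.Properties as Fin
open import Data.Fin.Subset
open import Data.Fin.Subset.Properties
open import Data.List as List using (List; []; _∷_; map; length; _++_)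
open import Data.List.Membership.Propositional using () renaming (_∈_ to _∈ₗ_)
open import Data.List.Membership.Propositional.Properties using (∈-∃++; ∈-tabulate⁺)
open import Data.List.Properties using (tabulate-lookup; length-tabulate)
open import Data.List.Relation.Binary.Permutation.Propositional using (_↭_; refl; prep; swap; ↭-sym; ↭-trans) renaming (trans to transitive)
open import Data.List.Relation.Binary.Permutation.Propositional.Properties using (All-resp-↭; ∈-resp-↭; ↭-length; map⁺; shift; shifts)
open import Data.List.Relation.Unary.All as All using (All; []; _∷_)
open import Data.List.Relation.Unary.All.Properties using () renaming (tabulate⁺ to All-tabulate⁺; tabulate⁻ to All-tabulate⁻)
open import Data.List.Relation.Unary.Any using (here; there)
open import Data.Nat using (ℕ; zero; suc; _+_; _*_; _∸_; _≤_; _<_; _⊓_; z≤n; s≤s; NonZero; _%_; _≤?_; _<?_)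
open import Data.Nat.DivMod using (_mod_; %-distribˡ-+; m<n⇒m%n≡m; m%n<n; n%n≡0)
open import Data.Nat.Divisibility using (_∣_; ∣⇒≤; m%n≡0⇒n∣m)
open import Data.Nat.ListAction using (sum)
open import Data.Nat.ListAction.Properties using (sum-↭)
open import Data.Nat.Primality using (Prime; euclidsLemma)
open import Data.Nat.Properties
open import Data.Nat.Solver using (module +-*-Solver)
open import Data.Product using (∃; ∃₂; _×_; _,_; proj₁; proj₂)
open import Data.Sum using (_⊎_; inj₁; inj₂)
open import Data.Vec using (_∷_; []; lookup; tabulate; here; there)
open import Data.Vec.Properties using (lookup∘tabulate; lookup-zipWith; []=⇒lookup; lookup⇒[]=)
open import Function using (_∘_)
open import Function.Bundles using (_⇔_; mk⇔; Equivalence)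
open import Relation.Binary.PropositionalEquality using (_≡_; _≢_; refl; sym; trans; cong; cong₂; subst; subst₂; isEquivalence; module ≡-Reasoning)
open import Relation.Nullary using (¬_; Dec; yes; no; does; contradiction)
open import Relation.Nullary.Decidable using (dec-true; _×-dec_; _⊎-dec_; ¬?)

-- Uncrossing yields only an inclusion of sumsets, but in the extremal case this suffices: each
-- reduction to `ℓ` sets has total size `∑ μ₀`, so Cauchy-Davenport already gives its sumset as many
-- elements as `S`. Hence every reduction, in whatever order it is made, has sumset `S` and is an
-- equality case, and the order can be chosen to expose a wanted member.
--
-- A progression does not determine its difference (`d` and its negative both serve), so differences
-- from separate uses of Vosper's theorem are never compared. One nonzero `d` is obtained once and
-- then carried along: in a tight pair whose sumset is not everything, a progression of size at
-- least two passes its own `d` to its partner.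
--
-- Vosper's theorem needs two residues outside the sumset of a pair. For `ℓ = 2` that sumset is all
-- of `S`, whence the bound `p - 1`; for `ℓ ≥ 3` a third set of size at least two makes `S` larger
-- than the sumset of the pair, so one residue outside `S` is enough.

setOf : ∀ {n} {P : Fin n → Set} → (∀ x → Dec (P x)) → Subset n
setOf P? = tabulate (λ x → does (P? x))

∈-setOf⁺ : ∀ {n} {P : Fin n → Set} (P? : ∀ x → Dec (P x)) {x} → P x → x ∈ setOf P?
∈-setOf⁺ P? {x} px = lookup⇒[]= x _ (trans (lookup∘tabulate _ x) (dec-true (P? x) px))

∈-setOf⁻ : ∀ {n} {P : Fin n → Set} (P? : ∀ x → Dec (P x)) {x} → x ∈ setOf P? → P x
∈-setOf⁻ P? {x} x∈ with P? x | trans (sym (lookup∘tabulate (λ y → does (P? y)) x)) ([]=⇒lookup x∈)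
... | yes px | _ = px
... | no  _  | ()

-- Cardinalities of finite subsets

∣∪∣+∣∩∣ : ∀ {n} (p q : Subset n) → ∣ p ∪ q ∣ + ∣ p ∩ q ∣ ≡ ∣ p ∣ + ∣ q ∣
∣∪∣+∣∩∣ [] [] = refl
∣∪∣+∣∩∣ (true ∷ p) (true ∷ q) =
  cong suc (trans (+-suc _ _) (trans (cong suc (∣∪∣+∣∩∣ p q)) (sym (+-suc _ _))))
∣∪∣+∣∩∣ (true ∷ p) (false ∷ q) = cong suc (∣∪∣+∣∩∣ p q)
∣∪∣+∣∩∣ (false ∷ p) (true ∷ q) = trans (cong suc (∣∪∣+∣∩∣ p q)) (sym (+-suc _ _))
∣∪∣+∣∩∣ (false ∷ p) (false ∷ q) = ∣∪∣+∣∩∣ p q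

∣p∣≤1+∣p-x∣ : ∀ {n} (p : Subset n) x → ∣ p ∣ ≤ suc ∣ p - x ∣
∣p∣≤1+∣p-x∣ p x = begin
  ∣ p ∣                             ≤⟨ p⊆q⇒∣p∣≤∣q∣ p⊆ ⟩
  ∣ ⁅ x ⁆ ∪ (p - x) ∣               ≤⟨ m≤m+n _ _ ⟩
  ∣ ⁅ x ⁆ ∪ (p - x) ∣ + ∣ ⁅ x ⁆ ∩ (p - x) ∣ ≡⟨ ∣∪∣+∣∩∣ ⁅ x ⁆ (p - x) ⟩
  ∣ ⁅ x ⁆ ∣ + ∣ p - x ∣             ≡⟨ cong (_+ ∣ p - x ∣) (∣⁅x⁆∣≡1 x) ⟩
  suc ∣ p - x ∣                     ∎
  where
  open ≤-Reasoning
  p⊆ : p ⊆ ⁅ x ⁆ ∪ (p - x)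
  p⊆ {y} y∈p with y ∈? ⁅ x ⁆
  ... | yes y∈x = x∈p∪q⁺ (inj₁ y∈x)
  ... | no  y∉x = x∈p∪q⁺ (inj₂ (x∈p∧x∉q⇒x∈p─q y∈p y∉x))

x∈p⇒1≤∣p∣ : ∀ {n} {p : Subset n} {x} → x ∈ p → 1 ≤ ∣ p ∣
x∈p⇒1≤∣p∣ x∈p = ≤-trans (s≤s z≤n) (x∈p⇒∣p-x∣<∣p∣ x∈p)

1≤∣p∣⇒nonempty : ∀ {n} (p : Subset n) → 1 ≤ ∣ p ∣ → Nonempty p
1≤∣p∣⇒nonempty {n} p 1≤ with nonempty? p
... | yes ne = ne
... | no ¬ne with () ← subst (1 ≤_) (trans (cong ∣_∣ (Empty-unique ¬ne)) (∣⊥∣≡0 n)) 1≤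

distinct⇒2≤∣p∣ : ∀ {n} {p : Subset n} {x y} → x ∈ p → y ∈ p → x ≢ y → 2 ≤ ∣ p ∣
distinct⇒2≤∣p∣ x∈p y∈p x≢y =
  ≤-trans (s≤s (x∈p⇒1≤∣p∣ (x∈p∧x≢y⇒x∈p-y y∈p (x≢y ∘ sym)))) (x∈p⇒∣p-x∣<∣p∣ x∈p)

x∈p─q⇒x∉q : ∀ {n} (p q : Subset n) {x} → x ∈ p ─ q → x ∉ q
x∈p─q⇒x∉q (_ ∷ p) (true ∷ q)  {zero}  ()
x∈p─q⇒x∉q (_ ∷ p) (false ∷ q) {zero}  _          ()
x∈p─q⇒x∉q (_ ∷ p) (_ ∷ q)     {suc x} (there x∈) (there x∈q) = x∈p─q⇒x∉q p q x∈ x∈q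

x∉p-x : ∀ {n} (p : Subset n) x → x ∉ p - x
x∉p-x p x x∈ = x∈p─q⇒x∉q p ⁅ x ⁆ x∈ (x∈⁅x⁆ x)

another : ∀ {n} (p : Subset n) → 2 ≤ ∣ p ∣ → ∀ x → ∃ λ y → y ∈ p × y ≢ x
another p 2≤ x with y , y∈ ← 1≤∣p∣⇒nonempty (p - x) (≤-pred (≤-trans 2≤ (∣p∣≤1+∣p-x∣ p x))) =
  y , p─q⊆p p ⁅ x ⁆ y∈ , λ { refl → x∉p-x p x y∈ }

2≤∣p∣⇒distinct : ∀ {n} (p : Subset n) → 2 ≤ ∣ p ∣ → ∃₂ λ x y → x ∈ p × y ∈ p × x ≢ y
2≤∣p∣⇒distinct p 2≤ with x , x∈ ← 1≤∣p∣⇒nonempty p (≤-trans (s≤s z≤n) 2≤)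
  with y , y∈ , y≢x ← another p 2≤ x = x , y , x∈ , y∈ , y≢x ∘ sym

⊆∧∣∣≥⇒⊇ : ∀ {n} {p q : Subset n} → p ⊆ q → ∣ q ∣ ≤ ∣ p ∣ → q ⊆ p
⊆∧∣∣≥⇒⊇ {p = p} p⊆q ∣q∣≤∣p∣ {x} x∈q with x ∈? p
... | yes x∈p = x∈p
... | no  x∉p = ⊥-elim (<⇒≱ (p⊂q⇒∣p∣<∣q∣ (p⊆q , x , x∈q , x∉p)) ∣q∣≤∣p∣)

∣p∣≥n⇒full : ∀ {n} (p : Subset n) → n ≤ ∣ p ∣ → ∀ x → x ∈ p
∣p∣≥n⇒full p n≤ x = subst (x ∈_) (sym (∣p∣≡n⇒p≡⊤ (≤-antisym (∣p∣≤n p) n≤))) ∈⊤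

full⇒∣p∣≥n : ∀ {n} (p : Subset n) → (∀ x → x ∈ p) → n ≤ ∣ p ∣
full⇒∣p∣≥n {n} p full = subst (_≤ ∣ p ∣) (∣⊤∣≡n n) (p⊆q⇒∣p∣≤∣q∣ {p = ⊤} (λ _ → full _))

injective⇒∣∣≤ : ∀ {n m} (f : Fin n → Fin m) (p : Subset n) (q : Subset m) →
  (∀ {x y} → x ∈ p → y ∈ p → f x ≡ f y → x ≡ y) → (∀ {x} → x ∈ p → f x ∈ q) → ∣ p ∣ ≤ ∣ q ∣
injective⇒∣∣≤ f [] q inj mem = z≤n
injective⇒∣∣≤ f (false ∷ p) q inj mem =
  injective⇒∣∣≤ (f ∘ suc) p q (λ x y e → Fin.suc-injective (inj (there x) (there y) e)) (mem ∘ there)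
injective⇒∣∣≤ f (true ∷ p) q inj mem =
  ≤-trans (s≤s (injective⇒∣∣≤ (f ∘ suc) p (q - f zero)
      (λ x y e → Fin.suc-injective (inj (there x) (there y) e))
      (λ x∈ → x∈p∧x≢y⇒x∈p-y (mem (there x∈)) (λ e → Fin.0≢1+n (inj here (there x∈) (sym e))))))
    (x∈p⇒∣p-x∣<∣p∣ (mem here))

-- The additive group of residues

module Cyclic (p : ℕ) .{{_ : NonZero p}} where

  infixl 6 _⊞_ _⊖_

  _⊞_ : Fin p → Fin p → Fin p
  _⊞_ = _+ₚ_ p

  0ₚ : Fin p
  0ₚ = 0 mod p

  ⊟_ : Fin p → Fin p
  ⊟ x = (p ∸ toℕ x) mod p

  _⊖_ : Fin p → Fin p → Fin p
  x ⊖ y = x ⊞ (⊟ y)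

  toℕ-mod : ∀ n → toℕ (n mod p) ≡ n % p
  toℕ-mod n = toℕ-fromℕ< (m%n<n n p)

  toℕ-% : ∀ (x : Fin p) → toℕ x % p ≡ toℕ x
  toℕ-% x = m<n⇒m%n≡m (toℕ<n x)

  mod-cong : ∀ {a b} → a % p ≡ b % p → a mod p ≡ b mod p
  mod-cong e = toℕ-injective (trans (toℕ-mod _) (trans e (sym (toℕ-mod _))))

  mod-toℕ : ∀ (x : Fin p) → toℕ x mod p ≡ x
  mod-toℕ x = toℕ-injective (trans (toℕ-mod _) (toℕ-% x))

  mod-⊞ : ∀ a b → a mod p ⊞ b mod p ≡ (a + b) mod p
  mod-⊞ a b = mod-cong (trans (cong₂ (λ u v → (u + v) % p) (toℕ-mod a) (toℕ-mod b))
                              (sym (%-distribˡ-+ a b p)))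

  ⊞-comm : ∀ x y → x ⊞ y ≡ y ⊞ x
  ⊞-comm x y = cong (_mod p) (+-comm (toℕ x) (toℕ y))

  ⊞-assoc : ∀ x y z → (x ⊞ y) ⊞ z ≡ x ⊞ (y ⊞ z)
  ⊞-assoc x y z = begin
    (x ⊞ y) ⊞ z                                ≡⟨ cong ((x ⊞ y) ⊞_) (sym (mod-toℕ z)) ⟩
    (toℕ x + toℕ y) mod p ⊞ toℕ z mod p        ≡⟨ mod-⊞ _ _ ⟩
    (toℕ x + toℕ y + toℕ z) mod p              ≡⟨ cong (_mod p) (+-assoc (toℕ x) _ _) ⟩
    (toℕ x + (toℕ y + toℕ z)) mod p            ≡⟨ mod-⊞ _ _ ⟨
    toℕ x mod p ⊞ (y ⊞ z)                      ≡⟨ cong (_⊞ (y ⊞ z)) (mod-toℕ x) ⟩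
    x ⊞ (y ⊞ z)                                ∎
    where open ≡-Reasoning

  ⊞-identityˡ : ∀ x → 0ₚ ⊞ x ≡ x
  ⊞-identityˡ x = trans (cong (0ₚ ⊞_) (sym (mod-toℕ x))) (trans (mod-⊞ 0 (toℕ x)) (mod-toℕ x))

  ⊞-inverseˡ : ∀ x → (⊟ x) ⊞ x ≡ 0ₚ
  ⊞-inverseˡ x = begin
    (⊟ x) ⊞ x                             ≡⟨ cong ((⊟ x) ⊞_) (sym (mod-toℕ x)) ⟩
    (p ∸ toℕ x) mod p ⊞ toℕ x mod p       ≡⟨ mod-⊞ _ _ ⟩
    (p ∸ toℕ x + toℕ x) mod p             ≡⟨ cong (_mod p) (m∸n+n≡m (<⇒≤ (toℕ<n x))) ⟩
    p mod p                               ≡⟨ mod-cong (trans (n%n≡0 p) (sym (m<n⇒m%n≡m (≤-<-trans z≤n (toℕ<n x))))) ⟩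
    0ₚ                                    ∎
    where open ≡-Reasoning

  ℤₚ : AbelianGroup _ _
  ℤₚ = record
    { Carrier = Fin p ; _≈_ = _≡_ ; _∙_ = _⊞_ ; ε = 0ₚ ; _⁻¹ = ⊟_
    ; isAbelianGroup = record
      { isGroup = record
        { isMonoid = record
          { isSemigroup = record
            { isMagma = record { isEquivalence = isEquivalence ; ∙-cong = cong₂ _⊞_ }
            ; assoc = ⊞-assoc }
          ; identity = ⊞-identityˡ , λ x → trans (⊞-comm x 0ₚ) (⊞-identityˡ x) }
        ; inverse = ⊞-inverseˡ , λ x → trans (⊞-comm x (⊟ x)) (⊞-inverseˡ x)
        ; ⁻¹-cong = cong ⊟_ }
      ; comm = ⊞-comm } }

  open AbelianGroupProperties ℤₚ public using (∙-cancelˡ; ∙-cancelʳ; //-rightDividesˡ; //-rightDividesʳ)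
  open CommutativeSemigroupProperties (AbelianGroup.commutativeSemigroup ℤₚ) public using (x∙yz≈y∙xz; xy∙z≈xz∙y; interchange)
  open AbelianGroup ℤₚ public using () renaming (identityʳ to ⊞-identityʳ; inverseʳ to ⊞-inverseʳ)

-- Arithmetic progressions modulo a prime

module Progressions (p : ℕ) .{{_ : NonZero p}} (pr : Prime p) where
  open Cyclic p public
  open Equivalence using (to; from)

  el : Fin p → Fin p → ℕ → Fin p
  el = apElem p

  AP : Fin p → Subset p → Set
  AP = IsAPWith p

  el-zero : ∀ a d → el a d 0 ≡ a
  el-zero a d = trans (cong (_mod p) (+-identityʳ (toℕ a))) (mod-toℕ a)

  el≡ : ∀ a d i → el a d i ≡ a ⊞ (i * toℕ d) mod p
  el≡ a d i = trans (sym (mod-⊞ (toℕ a) _)) (cong (_⊞ (i * toℕ d) mod p) (mod-toℕ a))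

  el-⊞ : ∀ a b d i j → el a d i ⊞ el b d j ≡ el (a ⊞ b) d (i + j)
  el-⊞ a b d i j = begin
    el a d i ⊞ el b d j                                     ≡⟨ cong₂ _⊞_ (el≡ a d i) (el≡ b d j) ⟩
    (a ⊞ (i * toℕ d) mod p) ⊞ (b ⊞ (j * toℕ d) mod p)       ≡⟨ interchange a _ b _ ⟩
    (a ⊞ b) ⊞ ((i * toℕ d) mod p ⊞ (j * toℕ d) mod p)       ≡⟨ cong ((a ⊞ b) ⊞_) (mod-⊞ _ _) ⟩
    (a ⊞ b) ⊞ (i * toℕ d + j * toℕ d) mod p                 ≡⟨ cong (λ n → (a ⊞ b) ⊞ n mod p) (*-distribʳ-+ (toℕ d) i j) ⟨
    (a ⊞ b) ⊞ ((i + j) * toℕ d) mod p                       ≡⟨ el≡ (a ⊞ b) d (i + j) ⟨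
    el (a ⊞ b) d (i + j)                                    ∎
    where open ≡-Reasoning

  el-⊞ˡ : ∀ a b d i → el a d i ⊞ b ≡ el (a ⊞ b) d i
  el-⊞ˡ a b d i = trans (cong (el a d i ⊞_) (sym (el-zero b d)))
                 (trans (el-⊞ a b d i 0) (cong (el (a ⊞ b) d) (+-identityʳ i)))

  el-suc : ∀ a d i → el a d (suc i) ≡ el a d i ⊞ d
  el-suc a d i = begin
    el a d (suc i)                        ≡⟨ el≡ a d (suc i) ⟩
    a ⊞ (toℕ d + i * toℕ d) mod p         ≡⟨ cong (a ⊞_) (trans (sym (mod-⊞ (toℕ d) _)) (cong (_⊞ (i * toℕ d) mod p) (mod-toℕ d))) ⟩
    a ⊞ (d ⊞ (i * toℕ d) mod p)           ≡⟨ cong (a ⊞_) (⊞-comm d _) ⟩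
    a ⊞ ((i * toℕ d) mod p ⊞ d)           ≡⟨ ⊞-assoc a _ d ⟨
    (a ⊞ (i * toℕ d) mod p) ⊞ d           ≡⟨ cong (_⊞ d) (el≡ a d i) ⟨
    el a d i ⊞ d                          ∎
    where open ≡-Reasoning

  el-shift : ∀ a d i → el (a ⊞ d) d i ≡ el a d (suc i)
  el-shift a d i = trans (sym (el-⊞ˡ a d d i)) (sym (el-suc a d i))

  module _ {d : Fin p} (d≢0 : toℕ d ≢ 0) where

    private
      el-injective-+ : ∀ a i k → k < p → el a d i ≡ el a d (i + k) → k ≡ 0
      el-injective-+ a i zero    k<p e = refl
      el-injective-+ a i (suc k) k<p e with euclidsLemma (suc k) (toℕ d) pr p∣
        where
        a0 : el a d i ⊞ 0ₚ ≡ el a d i ⊞ el 0ₚ d (suc k)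
        a0 = begin
          el a d i ⊞ 0ₚ                 ≡⟨ ⊞-identityʳ _ ⟩
          el a d i                      ≡⟨ e ⟩
          el a d (i + suc k)            ≡⟨ cong (λ u → el u d (i + suc k)) (⊞-identityʳ a) ⟨
          el (a ⊞ 0ₚ) d (i + suc k)     ≡⟨ el-⊞ a 0ₚ d i (suc k) ⟨
          el a d i ⊞ el 0ₚ d (suc k)    ∎
          where open ≡-Reasoning
        zero-multiple : 0ₚ ≡ (suc k * toℕ d) mod p
        zero-multiple = trans (∙-cancelˡ _ _ _ a0) (trans (el≡ 0ₚ d (suc k)) (⊞-identityˡ _))
        p∣ : p ∣ suc k * toℕ d
        p∣ = m%n≡0⇒n∣m _ p (trans (sym (toℕ-mod _))
               (trans (cong toℕ (sym zero-multiple)) (trans (toℕ-mod 0) (m<n⇒m%n≡m (≤-<-trans z≤n k<p)))))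
      ... | inj₁ p∣k = ⊥-elim (<⇒≱ k<p (∣⇒≤ p∣k))
      ... | inj₂ p∣d with toℕ d in eq
      ...   | zero  = ⊥-elim (d≢0 refl)
      ...   | suc _ = ⊥-elim (<⇒≱ (subst (_< p) eq (toℕ<n d)) (∣⇒≤ p∣d))

    el-injective : ∀ a {i j} → i < p → j < p → el a d i ≡ el a d j → i ≡ j
    el-injective a {i} {j} i<p j<p e with ≤-total i j
    ... | inj₁ i≤j = trans (sym (+-identityʳ i)) (trans (cong (i +_) (sym z)) (m+[n∸m]≡n i≤j))
      where z = el-injective-+ a i (j ∸ i) (≤-<-trans (m∸n≤m j i) j<p) (trans e (cong (el a d) (sym (m+[n∸m]≡n i≤j))))
    ... | inj₂ j≤i = sym (trans (sym (+-identityʳ j)) (trans (cong (j +_) (sym z)) (m+[n∸m]≡n j≤i)))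
      where z = el-injective-+ a j (i ∸ j) (≤-<-trans (m∸n≤m i j) i<p) (trans (sym e) (cong (el a d) (sym (m+[n∸m]≡n j≤i))))

    k≤∣AP∣ : ∀ a k (B : Subset p) → k ≤ p → (∀ i → i < k → el a d i ∈ B) → k ≤ ∣ B ∣
    k≤∣AP∣ a k B k≤p mem = subst (_≤ ∣ B ∣) (∣⊤∣≡n k) (injective⇒∣∣≤ (el a d ∘ toℕ) ⊤ B
      (λ {i} {j} _ _ e → toℕ-injective (el-injective a (<-≤-trans (toℕ<n i) k≤p) (<-≤-trans (toℕ<n j) k≤p) e))
      (λ {i} _ → mem (toℕ i) (toℕ<n i)))

    -- The first `p` terms are distinct, so by counting they exhaust the residues.
    el-surjective : ∀ a x → ∃ λ i → i < p × x ≡ el a d i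
    el-surjective a x = let i , e = ∈-setOf⁻ P? (∣p∣≥n⇒full (setOf P?) (k≤∣AP∣ a p (setOf P?) ≤-refl mem) x)
                        in toℕ i , toℕ<n i , e
      where
      P? : ∀ y → Dec (∃ λ (i : Fin p) → y ≡ el a d (toℕ i))
      P? y = any? (λ i → y Fin.≟ el a d (toℕ i))
      mem : ∀ i → i < p → el a d i ∈ setOf P?
      mem i i<p = ∈-setOf⁺ P? (fromℕ< i<p , cong (el a d) (sym (toℕ-fromℕ< i<p)))

  ∣AP∣≤k : ∀ a d k (B : Subset p) → (∀ {x} → x ∈ B → ∃ λ i → i < k × x ≡ el a d i) → ∣ B ∣ ≤ k
  ∣AP∣≤k a d zero B mem with nonempty? B
  ... | yes (x , x∈B) with _ , () , _ ← mem x∈B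
  ... | no ¬ne = ≤-reflexive (trans (cong ∣_∣ (Empty-unique ¬ne)) (∣⊥∣≡0 p))
  ∣AP∣≤k a d (suc k) B mem = ≤-trans (∣p∣≤1+∣p-x∣ B (el a d k)) (s≤s (∣AP∣≤k a d k (B - el a d k) mem′))
    where
    mem′ : ∀ {x} → x ∈ B - el a d k → ∃ λ i → i < k × x ≡ el a d i
    mem′ {x} x∈ with i , i<1+k , e ← mem (p─q⊆p B _ x∈) =
      i , ≤∧≢⇒< (≤-pred i<1+k) (λ { refl → x∉p-x B (el a d k) (subst (_∈ B - el a d k) e x∈) }) , e

  -- The length in `IsAPWith` may exceed `p`, when the enumeration wraps around and `B` is
  -- everything; with `∣ B ∣` as length it is free of repetition in all cases.
  AP-normalise : ∀ {d B} → toℕ d ≢ 0 → AP d B →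
    ∃ λ a → ∀ x → (x ∈ B) ⇔ (∃ λ i → i < ∣ B ∣ × x ≡ el a d i)
  AP-normalise {d} {B} d≢0 (a , k , iff) with ≤-total k p
  ... | inj₁ k≤p = a , subst (λ n → ∀ x → (x ∈ B) ⇔ (∃ λ i → i < n × x ≡ el a d i)) k≡ iff
    where
    k≡ : k ≡ ∣ B ∣
    k≡ = ≤-antisym (k≤∣AP∣ d≢0 a k B k≤p (λ i i<k → from (iff _) (i , i<k , refl)))
                   (∣AP∣≤k a d k B (λ x∈B → to (iff _) x∈B))
  ... | inj₂ p≤k = a , λ x → mk⇔
        (λ _ → let i , i<p , e = el-surjective d≢0 a x in i , <-≤-trans i<p (full⇒∣p∣≥n B full) , e)
        (λ _ → full x)
    where
    full : ∀ x → x ∈ B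
    full x = let i , i<p , e = el-surjective d≢0 a x in from (iff x) (i , <-≤-trans i<p p≤k , e)

  -- A start is a point outside `C` from which a step by `d` enters `C`. For nonempty `C` and
  -- `d ≠ 0`, having at most one start is equivalent to being a progression with difference `d`; the
  -- full set has none. As neither a first term nor a length is mentioned, the condition is easy to
  -- check for sumsets, complements and unions.
  OneStart : Fin p → Subset p → Set
  OneStart d C = ∀ x y → x ∉ C → x ⊞ d ∈ C → y ∉ C → y ⊞ d ∈ C → x ≡ y

  AP⇒OneStart : ∀ {d C} → AP d C → OneStart d C
  AP⇒OneStart {d} {C} (a , k , iff) x y x∉ x+d∈ y∉ y+d∈ =
    ∙-cancelʳ d x y (trans (start x x∉ x+d∈) (sym (start y y∉ y+d∈)))
    where
    start : ∀ x → x ∉ C → x ⊞ d ∈ C → x ⊞ d ≡ a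
    start x x∉ x+d∈ with to (iff _) x+d∈
    ... | zero  , _   , e = trans e (el-zero a d)
    ... | suc i , i<k , e = ⊥-elim (x∉ (from (iff x) (i , <⇒≤ i<k , ∙-cancelʳ d _ _ (trans e (el-suc a d i)))))

  private
    initial-segment : ∀ {P : ℕ → Set} → (∀ i → Dec (P i)) → ∀ n →
      (∀ i → suc i < n → P (suc i) → P i) → ∃ λ k → k ≤ n × (∀ i → i < n → P i → i < k) × (∀ i → i < k → P i)
    initial-segment P? zero down = 0 , z≤n , (λ _ ()) , (λ _ ())
    initial-segment {P} P? (suc n) down with P? n
    ... | yes pn = suc n , ≤-refl , (λ _ i<n _ → i<n) , λ i i<1+n → descend n ≤-refl pn i (≤-pred i<1+n)
      where
      descend : ∀ m → m < suc n → P m → ∀ i → i ≤ m → P i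
      descend zero m< pm zero z≤n = pm
      descend (suc m) m< pm i i≤ with m≤n⇒m<n∨m≡n i≤
      ... | inj₁ i<1+m = descend m (<⇒≤ m<) (down m m< pm) i (≤-pred i<1+m)
      ... | inj₂ refl  = pm
    ... | no ¬pn with k , k≤n , below , all ← initial-segment P? n (λ i i< → down i (m≤n⇒m≤1+n i<)) =
      k , m≤n⇒m≤1+n k≤n , (λ i i<1+n pi → below i (≤∧≢⇒< (≤-pred i<1+n) (λ { refl → ¬pn pi })) pi) , all

  module _ {d : Fin p} {C : Subset p} (d≢0 : toℕ d ≢ 0) (one : OneStart d C) where

    start⇒AP : ∀ s → s ∉ C → s ⊞ d ∈ C → AP d C
    start⇒AP s s∉C s+d∈C with initial-segment (λ i → el (s ⊞ d) d i ∈? C) p down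
      where
      down : ∀ i → suc i < p → el (s ⊞ d) d (suc i) ∈ C → el (s ⊞ d) d i ∈ C
      down i i<p e with el (s ⊞ d) d i ∈? C
      ... | yes i∈ = i∈
      -- Entering `C` again here would make `el (s ⊞ d) d i` a start, hence equal to `s`: the walk
      -- would be back at `s ⊞ d` after fewer than `p` steps.
      ... | no  i∉ = ⊥-elim (1+n≢0 (el-injective d≢0 (s ⊞ d) i<p (≤-<-trans z≤n i<p)
                       (trans (el-suc _ d i)
                       (trans (cong (_⊞ d) (one _ s i∉ (subst (_∈ C) (el-suc _ d i) e) s∉C s+d∈C))
                              (sym (el-zero _ d))))))
    ... | k , k≤p , below , all = s ⊞ d , k , λ x → mk⇔
      (λ x∈C → let i , i<p , e = el-surjective d≢0 (s ⊞ d) x in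
               i , below i i<p (subst (_∈ C) e x∈C) , e)
      (λ { (i , i<k , refl) → all i i<k })

    find-start : ∀ z → z ∉ C → ∀ n → el z d n ∈ C → ∃ λ s → s ∉ C × s ⊞ d ∈ C
    find-start z z∉C zero e = ⊥-elim (z∉C (subst (_∈ C) (el-zero z d) e))
    find-start z z∉C (suc n) e with el z d n ∈? C
    ... | yes n∈ = find-start z z∉C n n∈
    ... | no  n∉ = el z d n , n∉ , subst (_∈ C) (el-suc z d n) e

    OneStart⇒AP : Nonempty C → AP d C
    OneStart⇒AP (c , c∈C) with all? (_∈? C)
    ... | yes full = c , p , λ x → mk⇔ (λ _ → el-surjective d≢0 c x) (λ _ → full x)
    ... | no ¬full =
      let z , z∉C = Fin.¬∀⟶∃¬ p _ (_∈? C) ¬full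
          n , _ , c≡ = el-surjective d≢0 z c
          s , s∉C , s+d∈C = find-start z z∉C n (subst (_∈ C) c≡ c∈C)
      in start⇒AP s s∉C s+d∈C

-- Cauchy-Davenport and the transfer of a difference

module Sumsets (p : ℕ) .{{_ : NonZero p}} (pr : Prime p) where
  open Progressions p pr public
  open Equivalence using (to; from)

  infixr 6 _⊕_

  InSum? : ∀ (A B : Subset p) x → Dec (∃₂ λ a b → a ∈ A × b ∈ B × x ≡ a ⊞ b)
  InSum? A B x = any? λ a → any? λ b → (a ∈? A) ×-dec (b ∈? B) ×-dec (x Fin.≟ a ⊞ b)

  _⊕_ : Subset p → Subset p → Subset p
  A ⊕ B = setOf (InSum? A B)

  ∈-⊕⁺ : ∀ {A B a b} → a ∈ A → b ∈ B → a ⊞ b ∈ A ⊕ B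
  ∈-⊕⁺ {A} {B} a∈A b∈B = ∈-setOf⁺ (InSum? A B) (_ , _ , a∈A , b∈B , refl)

  ∈-⊕⁻ : ∀ {A B x} → x ∈ A ⊕ B → ∃₂ λ a b → a ∈ A × b ∈ B × x ≡ a ⊞ b
  ∈-⊕⁻ {A} {B} = ∈-setOf⁻ (InSum? A B)

  ⊕-comm : ∀ A B → A ⊕ B ≡ B ⊕ A
  ⊕-comm A B = ⊆-antisym (flip A B) (flip B A)
    where
    flip : ∀ A B → A ⊕ B ⊆ B ⊕ A
    flip A B x∈ with a , b , a∈ , b∈ , refl ← ∈-⊕⁻ x∈ = subst (_∈ B ⊕ A) (⊞-comm b a) (∈-⊕⁺ b∈ a∈)

  ⊕-assoc : ∀ A B C → (A ⊕ B) ⊕ C ≡ A ⊕ (B ⊕ C)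
  ⊕-assoc A B C = ⊆-antisym l r
    where
    l : (A ⊕ B) ⊕ C ⊆ A ⊕ (B ⊕ C)
    l x∈ with _ , c , ab∈ , c∈ , refl ← ∈-⊕⁻ x∈ with a , b , a∈ , b∈ , refl ← ∈-⊕⁻ ab∈ =
      subst (_∈ A ⊕ (B ⊕ C)) (sym (⊞-assoc a b c)) (∈-⊕⁺ a∈ (∈-⊕⁺ b∈ c∈))
    r : A ⊕ (B ⊕ C) ⊆ (A ⊕ B) ⊕ C
    r x∈ with a , _ , a∈ , bc∈ , refl ← ∈-⊕⁻ x∈ with b , c , b∈ , c∈ , refl ← ∈-⊕⁻ bc∈ =
      subst (_∈ (A ⊕ B) ⊕ C) (⊞-assoc a b c) (∈-⊕⁺ (∈-⊕⁺ a∈ b∈) c∈)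

  ∣A∣≤∣A⊕B∣ : ∀ A B → Nonempty B → ∣ A ∣ ≤ ∣ A ⊕ B ∣
  ∣A∣≤∣A⊕B∣ A B (b , b∈) =
    injective⇒∣∣≤ (_⊞ b) A (A ⊕ B) (λ _ _ → ∙-cancelʳ b _ _) (λ a∈ → ∈-⊕⁺ a∈ b∈)

  ⊕-nonempty : ∀ {A B} → Nonempty A → Nonempty B → Nonempty (A ⊕ B)
  ⊕-nonempty (_ , a∈) (_ , b∈) = _ , ∈-⊕⁺ a∈ b∈

  ⊖≢0 : ∀ {x y} → x ≢ y → toℕ (x ⊖ y) ≢ 0
  ⊖≢0 {x} {y} x≢y e = x≢y (trans (sym (//-rightDividesˡ y x)) (trans (cong (_⊞ y) x-y≡0) (⊞-identityˡ y)))
    where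
    x-y≡0 : x ⊖ y ≡ 0ₚ
    x-y≡0 = toℕ-injective (trans e (sym (trans (toℕ-mod 0) (m<n⇒m%n≡m (≤-<-trans z≤n (toℕ<n x))))))

  closed⇒full : ∀ {t A} → toℕ t ≢ 0 → Nonempty A → (∀ {x} → x ∈ A → x ⊞ t ∈ A) → ∀ x → x ∈ A
  closed⇒full {t} {A} t≢0 (a , a∈) closed x with i , _ , refl ← el-surjective t≢0 a x = go i
    where
    go : ∀ i → el a t i ∈ A
    go zero = subst (_∈ A) (sym (el-zero a t)) a∈
    go (suc i) = subst (_∈ A) (sym (el-suc a t i)) (closed (go i))

  -- Dyson's e-transform (A ∪ (B + e) , B ∩ (A − e)).
  module Transform (A B : Subset p) (e : Fin p) where

    inA? : ∀ x → Dec (x ∈ A ⊎ x ⊖ e ∈ B)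
    inA? x = (x ∈? A) ⊎-dec (x ⊖ e ∈? B)

    inB? : ∀ x → Dec (x ∈ B × x ⊞ e ∈ A)
    inB? x = (x ∈? B) ×-dec (x ⊞ e ∈? A)

    Aₑ Bₑ : Subset p
    Aₑ = setOf inA?
    Bₑ = setOf inB?

    A⊆Aₑ : A ⊆ Aₑ
    A⊆Aₑ x∈ = ∈-setOf⁺ inA? (inj₁ x∈)

    B+e⊆Aₑ : ∀ {b} → b ∈ B → b ⊞ e ∈ Aₑ
    B+e⊆Aₑ {b} b∈ = ∈-setOf⁺ inA? (inj₂ (subst (_∈ B) (sym (//-rightDividesʳ e b)) b∈))

    Bₑ⊆B : Bₑ ⊆ B
    Bₑ⊆B x∈ = proj₁ (∈-setOf⁻ inB? x∈)

    Bₑ+e⊆A : ∀ {x} → x ∈ Bₑ → x ⊞ e ∈ A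
    Bₑ+e⊆A x∈ = proj₂ (∈-setOf⁻ inB? x∈)

    ∈Bₑ : ∀ {x} → x ∈ B → x ⊞ e ∈ A → x ∈ Bₑ
    ∈Bₑ x∈ x+e∈ = ∈-setOf⁺ inB? (x∈ , x+e∈)

    -- When `x ⊖ e` is in `B`, the shift by `e` is moved from `x` to `y`, whose translate `y ⊞ e`
    -- lies in `A`.
    Aₑ⊕Bₑ⊆A⊕B : Aₑ ⊕ Bₑ ⊆ A ⊕ B
    Aₑ⊕Bₑ⊆A⊕B z∈ with x , y , x∈ , y∈ , refl ← ∈-⊕⁻ z∈ with ∈-setOf⁻ inA? x∈
    ... | inj₁ x∈A = ∈-⊕⁺ x∈A (Bₑ⊆B y∈)
    ... | inj₂ x-e∈B = subst (_∈ A ⊕ B) eq (∈-⊕⁺ (Bₑ+e⊆A y∈) x-e∈B)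
      where
      open ≡-Reasoning
      eq : (y ⊞ e) ⊞ (x ⊖ e) ≡ x ⊞ y
      eq = begin
        (y ⊞ e) ⊞ (x ⊖ e)  ≡⟨ ⊞-assoc y e (x ⊖ e) ⟩
        y ⊞ (e ⊞ (x ⊖ e))  ≡⟨ cong (y ⊞_) (trans (⊞-comm e _) (//-rightDividesˡ e x)) ⟩
        y ⊞ x              ≡⟨ ⊞-comm y x ⟩
        x ⊞ y              ∎

    ∣A∣+∣B∣≤ : ∣ A ∣ + ∣ B ∣ ≤ ∣ Aₑ ∣ + ∣ Bₑ ∣
    ∣A∣+∣B∣≤ = begin
      ∣ A ∣ + ∣ B ∣               ≤⟨ +-monoʳ-≤ ∣ A ∣ (injective⇒∣∣≤ (_⊞ e) B B+e (λ _ _ → ∙-cancelʳ e _ _) shifted) ⟩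
      ∣ A ∣ + ∣ B+e ∣             ≡⟨ ∣∪∣+∣∩∣ A B+e ⟨
      ∣ A ∪ B+e ∣ + ∣ A ∩ B+e ∣   ≤⟨ +-mono-≤ (p⊆q⇒∣p∣≤∣q∣ union)
                                       (injective⇒∣∣≤ (_⊖ e) (A ∩ B+e) Bₑ (λ _ _ → ∙-cancelʳ (⊟ e) _ _) inter) ⟩
      ∣ Aₑ ∣ + ∣ Bₑ ∣             ∎
      where
      open ≤-Reasoning
      inB+e? : ∀ x → Dec (x ⊖ e ∈ B)
      inB+e? x = x ⊖ e ∈? B
      B+e = setOf inB+e?
      shifted : ∀ {b} → b ∈ B → b ⊞ e ∈ B+e
      shifted {b} b∈ = ∈-setOf⁺ inB+e? (subst (_∈ B) (sym (//-rightDividesʳ e b)) b∈)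
      union : A ∪ B+e ⊆ Aₑ
      union x∈ with x∈p∪q⁻ A B+e x∈
      ... | inj₁ x∈A = A⊆Aₑ x∈A
      ... | inj₂ x∈B = ∈-setOf⁺ inA? (inj₂ (∈-setOf⁻ inB+e? x∈B))
      inter : ∀ {x} → x ∈ A ∩ B+e → x ⊖ e ∈ Bₑ
      inter {x} x∈ with x∈A , x∈B ← x∈p∩q⁻ A B+e x∈ =
        ∈Bₑ (∈-setOf⁻ inB+e? x∈B) (subst (_∈ A) (sym (//-rightDividesˡ e x)) x∈A)

  -- Induction on `∣ B ∣`. If no transform shrinks `B` to a smaller nonempty set, take `e = a ⊖ b₀`
  -- with `a` in `A`: it keeps `b₀`, hence all of `B`, so `b ⊞ (a ⊖ b₀)` is again in `A`. Unless `B`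
  -- is a single point, `A` is then stable under a nonzero shift `b ⊖ b₀` and is everything, against
  -- `∣ A ⊕ B ∣ < p`.
  cauchyDavenport : ∀ A B → Nonempty A → Nonempty B → ∣ A ⊕ B ∣ < p → ∣ A ∣ + ∣ B ∣ ≤ suc ∣ A ⊕ B ∣
  cauchyDavenport A B ne ne′ = go ∣ B ∣ A B ≤-refl ne ne′
    where
    go : ∀ n A B → ∣ B ∣ ≤ n → Nonempty A → Nonempty B → ∣ A ⊕ B ∣ < p → ∣ A ∣ + ∣ B ∣ ≤ suc ∣ A ⊕ B ∣
    go zero A B B≤0 _ (_ , b∈) _ = ⊥-elim (<⇒≱ (x∈p⇒1≤∣p∣ b∈) B≤0)
    go (suc n) A B B≤ (a₀ , a₀∈) (b₀ , b₀∈) <p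
      with any? (λ e → nonempty? (Transform.Bₑ A B e) ×-dec (∣ Transform.Bₑ A B e ∣ <? ∣ B ∣))
    ... | yes (e , neₑ , Bₑ<B) = begin
        ∣ A ∣ + ∣ B ∣      ≤⟨ ∣A∣+∣B∣≤ ⟩
        ∣ Aₑ ∣ + ∣ Bₑ ∣    ≤⟨ go n Aₑ Bₑ (≤-pred (≤-trans Bₑ<B B≤)) (a₀ , A⊆Aₑ a₀∈) neₑ (≤-<-trans ≤⊕ <p) ⟩
        suc ∣ Aₑ ⊕ Bₑ ∣    ≤⟨ s≤s ≤⊕ ⟩
        suc ∣ A ⊕ B ∣      ∎
      where
      open ≤-Reasoning
      open Transform A B e
      ≤⊕ = p⊆q⇒∣p∣≤∣q∣ Aₑ⊕Bₑ⊆A⊕B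
    ... | no none with ∣ B ∣ ≤? 1
    ...   | yes B≤1 = ≤-trans (+-mono-≤ (∣A∣≤∣A⊕B∣ A B (b₀ , b₀∈)) B≤1) (≤-reflexive (+-comm _ 1))
    ...   | no  B≰1 with b , b∈ , b≢b₀ ← another B (≰⇒> B≰1) b₀ =
      ⊥-elim (<⇒≱ <p (≤-trans (full⇒∣p∣≥n A (closed⇒full (⊖≢0 b≢b₀) (a₀ , a₀∈) closed)) (∣A∣≤∣A⊕B∣ A B (b₀ , b₀∈))))
      where
      closed : ∀ {a} → a ∈ A → a ⊞ (b ⊖ b₀) ∈ A
      closed {a} a∈ = subst (_∈ A) eq (Bₑ+e⊆A b∈Bₑ)
        where
        open Transform A B (a ⊖ b₀)
        b₀∈Bₑ : b₀ ∈ Bₑ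
        b₀∈Bₑ = ∈Bₑ b₀∈ (subst (_∈ A) (sym (trans (⊞-comm b₀ _) (//-rightDividesˡ b₀ a))) a∈)
        b∈Bₑ : b ∈ Bₑ
        b∈Bₑ = ⊆∧∣∣≥⇒⊇ Bₑ⊆B (≮⇒≥ (λ Bₑ<B → none (_ , (b₀ , b₀∈Bₑ) , Bₑ<B))) b∈
        eq : b ⊞ (a ⊖ b₀) ≡ a ⊞ (b ⊖ b₀)
        eq = x∙yz≈y∙xz b a (⊟ b₀)

  -- Trade one term of `B` for a thickening of `C`: with `B⁻ = B ∩ (B + d)`, which has at least
  -- `∣ B ∣ - 1` points, and `C⁺ = C ∪ (C − d)`, the sumset stays inside `B ⊕ C`. Cauchy-Davenport
  -- then allows `C⁺` at most one point beyond `C`, and these extra points are exactly the starts of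
  -- `C`.
  AP-transfer : ∀ {d B C} → toℕ d ≢ 0 → AP d B → 2 ≤ ∣ B ∣ → Nonempty C →
    ∣ B ⊕ C ∣ < p → suc ∣ B ⊕ C ∣ ≤ ∣ B ∣ + ∣ C ∣ → AP d C
  AP-transfer {d} {B} {C} d≢0 apB 2≤B (c , c∈) <p tight = OneStart⇒AP d≢0 one (c , c∈)
    where
    a = proj₁ (AP-normalise d≢0 apB)
    iff = proj₂ (AP-normalise d≢0 apB)
    k = ∣ B ∣ ∸ 1
    1+k≡ : suc k ≡ ∣ B ∣
    1+k≡ = m+[n∸m]≡n (≤-trans (s≤s z≤n) 2≤B)

    inB⁻? : ∀ x → Dec (x ∈ B × x ⊖ d ∈ B)
    inB⁻? x = (x ∈? B) ×-dec (x ⊖ d ∈? B)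
    inC⁺? : ∀ x → Dec (x ∈ C ⊎ x ⊞ d ∈ C)
    inC⁺? x = (x ∈? C) ⊎-dec (x ⊞ d ∈? C)
    B⁻ C⁺ : Subset p
    B⁻ = setOf inB⁻?
    C⁺ = setOf inC⁺?

    ⊕⊆ : B⁻ ⊕ C⁺ ⊆ B ⊕ C
    ⊕⊆ z∈ with x , y , x∈ , y∈ , refl ← ∈-⊕⁻ z∈ with x∈B , x-d∈B ← ∈-setOf⁻ inB⁻? x∈ with ∈-setOf⁻ inC⁺? y∈
    ... | inj₁ y∈C = ∈-⊕⁺ x∈B y∈C
    ... | inj₂ y+d∈C = subst (_∈ B ⊕ C) eq (∈-⊕⁺ x-d∈B y+d∈C)
      where
      open ≡-Reasoning
      eq : (x ⊖ d) ⊞ (y ⊞ d) ≡ x ⊞ y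
      eq = begin
        (x ⊖ d) ⊞ (y ⊞ d)  ≡⟨ interchange x (⊟ d) y d ⟩
        (x ⊞ y) ⊞ (⊟ d ⊞ d) ≡⟨ cong ((x ⊞ y) ⊞_) (⊞-inverseˡ d) ⟩
        (x ⊞ y) ⊞ 0ₚ        ≡⟨ ⊞-identityʳ _ ⟩
        x ⊞ y               ∎

    mem : ∀ i → i < k → el (a ⊞ d) d i ∈ B⁻
    mem i i<k = ∈-setOf⁺ inB⁻?
      ( from (iff _) (suc i , subst (suc i <_) 1+k≡ (s≤s i<k) , el-shift a d i)
      , from (iff _) (i , <-≤-trans i<k (m∸n≤m ∣ B ∣ 1) ,
          trans (cong (_⊖ d) (trans (el-shift a d i) (el-suc a d i))) (//-rightDividesʳ d _)))

    k≤B⁻ : k ≤ ∣ B⁻ ∣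
    k≤B⁻ = k≤∣AP∣ d≢0 (a ⊞ d) k B⁻ (≤-trans (m∸n≤m ∣ B ∣ 1) (∣p∣≤n B)) mem

    C⁺≤1+C : ∣ C⁺ ∣ ≤ suc ∣ C ∣
    C⁺≤1+C = +-cancelˡ-≤ ∣ B ∣ _ _ (begin
      ∣ B ∣ + ∣ C⁺ ∣            ≡⟨ cong (_+ ∣ C⁺ ∣) (sym 1+k≡) ⟩
      suc (k + ∣ C⁺ ∣)          ≤⟨ s≤s (+-monoˡ-≤ ∣ C⁺ ∣ k≤B⁻) ⟩
      suc (∣ B⁻ ∣ + ∣ C⁺ ∣)     ≤⟨ s≤s (cauchyDavenport B⁻ C⁺ neB⁻ (c , ∈-setOf⁺ inC⁺? (inj₁ c∈)) (≤-<-trans ≤⊕ <p)) ⟩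
      suc (suc ∣ B⁻ ⊕ C⁺ ∣)     ≤⟨ s≤s (s≤s ≤⊕) ⟩
      suc (suc ∣ B ⊕ C ∣)       ≤⟨ s≤s tight ⟩
      suc (∣ B ∣ + ∣ C ∣)       ≡⟨ +-suc ∣ B ∣ ∣ C ∣ ⟨
      ∣ B ∣ + suc ∣ C ∣         ∎)
      where
      open ≤-Reasoning
      ≤⊕ = p⊆q⇒∣p∣≤∣q∣ ⊕⊆
      neB⁻ = 1≤∣p∣⇒nonempty B⁻ (≤-trans (≤-pred (subst (2 ≤_) (sym 1+k≡) 2≤B)) k≤B⁻)

    one : OneStart d C
    one x y x∉ x+d∈ y∉ y+d∈ with x Fin.≟ y
    ... | yes x≡y = x≡y
    ... | no  x≢y = ⊥-elim (<⇒≱ (begin-strict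
      suc ∣ C ∣                 ≤⟨ s≤s (p⊆q⇒∣p∣≤∣q∣ C⊆) ⟩
      suc ∣ C⁺ - x - y ∣        ≤⟨ x∈p⇒∣p-x∣<∣p∣ (x∈p∧x≢y⇒x∈p-y (∈-setOf⁺ inC⁺? (inj₂ y+d∈)) (x≢y ∘ sym)) ⟩
      ∣ C⁺ - x ∣                <⟨ x∈p⇒∣p-x∣<∣p∣ (∈-setOf⁺ inC⁺? (inj₂ x+d∈)) ⟩
      ∣ C⁺ ∣                    ∎) C⁺≤1+C)
      where
      open ≤-Reasoning
      C⊆ : C ⊆ C⁺ - x - y
      C⊆ {z} z∈ = x∈p∧x≢y⇒x∈p-y (x∈p∧x≢y⇒x∈p-y (∈-setOf⁺ inC⁺? (inj₁ z∈)) (λ { refl → x∉ z∈ })) (λ { refl → y∉ z∈ })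

-- Vosper's theorem

module VosperTheorem (p : ℕ) .{{_ : NonZero p}} (pr : Prime p) where
  open Sumsets p pr public
  open Equivalence using (to; from)
  open AbelianGroupProperties ℤₚ using (⁻¹-injective; ⁻¹-anti-homo-∙; ⁻¹-involutive)

  -- If `x ⊞ d = u ⊞ v` where `u` or `v` is not the first term of its progression, stepping that one
  -- back puts `x` in the sumset. So every start `x` has `x ⊞ d = a ⊞ b`.
  ⊕-OneStart : ∀ {d A B} → AP d A → AP d B → OneStart d (A ⊕ B)
  ⊕-OneStart {d} {A} {B} (a , k , iffA) (b , l , iffB) x y x∉ x+d∈ y∉ y+d∈ =
    ∙-cancelʳ d x y (trans (start x x∉ x+d∈) (sym (start y y∉ y+d∈)))
    where
    start : ∀ x → x ∉ A ⊕ B → x ⊞ d ∈ A ⊕ B → x ⊞ d ≡ a ⊞ b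
    start x x∉ x+d∈ with u , v , u∈ , v∈ , e ← ∈-⊕⁻ x+d∈ with to (iffA u) u∈ | to (iffB v) v∈
    ... | zero , _ , refl | zero , _ , refl = trans e (cong₂ _⊞_ (el-zero a d) (el-zero b d))
    ... | suc i , i<k , refl | _ = ⊥-elim (x∉ (subst (_∈ A ⊕ B) (sym x≡) (∈-⊕⁺ (from (iffA _) (i , <⇒≤ i<k , refl)) v∈)))
      where
      x≡ : x ≡ el a d i ⊞ v
      x≡ = ∙-cancelʳ d _ _ (trans e (trans (cong (_⊞ v) (el-suc a d i)) (xy∙z≈xz∙y (el a d i) d v)))
    ... | zero , _ , refl | suc j , j<l , refl = ⊥-elim (x∉ (subst (_∈ A ⊕ B) (sym x≡) (∈-⊕⁺ u∈ (from (iffB _) (j , <⇒≤ j<l , refl)))))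
      where
      x≡ : x ≡ u ⊞ el b d j
      x≡ = ∙-cancelʳ d _ _ (trans e (trans (cong (u ⊞_) (el-suc b d j)) (sym (⊞-assoc u _ d))))

  -- With N = −(ℤₚ ∖ (A + B)), the sumset N + A misses −B, so (N , A) is again a critical pair.
  OneStart-⊕⇒AP : ∀ {d A B} → toℕ d ≢ 0 → Nonempty A → Nonempty B →
    suc ∣ A ⊕ B ∣ ≤ ∣ A ∣ + ∣ B ∣ → 2 + ∣ A ⊕ B ∣ ≤ p → OneStart d (A ⊕ B) → AP d A
  OneStart-⊕⇒AP {d} {A} {B} d≢0 neA (b , b∈) tight small one =
    AP-transfer d≢0 (OneStart⇒AP d≢0 oneN neN) 2≤N neA (≤-<-trans N⊕A≤ <p) tightN
    where
    E = A ⊕ B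
    inN? : ∀ x → Dec (⊟ x ∉ E)
    inN? x = ¬? (⊟ x ∈? E)
    N = setOf inN?
    in-B? : ∀ x → Dec (⊟ x ∉ B)
    in-B? x = ¬? (⊟ x ∈? B)
    -B = setOf in-B?

    ⊟-injective : ∀ {x y} → ⊟ x ≡ ⊟ y → x ≡ y
    ⊟-injective = ⁻¹-injective

    p∸E≤N : p ∸ ∣ E ∣ ≤ ∣ N ∣
    p∸E≤N = subst (_≤ ∣ N ∣) (∣∁p∣≡n∸∣p∣ E) (injective⇒∣∣≤ ⊟_ (∁ E) N (λ _ _ → ⊟-injective)
      (λ {x} x∈ → ∈-setOf⁺ inN? (λ e → x∈∁p⇒x∉p x∈ (subst (_∈ E) (⁻¹-involutive x) e))))

    -- The two residues outside `E` are used here: `AP-transfer` takes `N` as its progression of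
    -- size at least two.
    2≤N : 2 ≤ ∣ N ∣
    2≤N = ≤-trans (m+n≤o⇒m≤o∸n 2 small) p∸E≤N

    neN : Nonempty N
    neN = 1≤∣p∣⇒nonempty N (≤-trans (s≤s z≤n) 2≤N)

    -- Complementing exchanges entering and leaving along `d`, and negation reverses the steps, so
    -- starts of `N` correspond to starts of `E`.
    oneN : OneStart d N
    oneN x y x∉ x+d∈ y∉ y+d∈ = ∙-cancelʳ d x y (⊟-injective
        (one _ _ (∈-setOf⁻ inN? x+d∈) (end x x∉) (∈-setOf⁻ inN? y+d∈) (end y y∉)))
      where
      end : ∀ x → x ∉ N → ⊟ (x ⊞ d) ⊞ d ∈ E
      end x x∉ with ⊟ x ∈? E
      ... | yes -x∈ = subst (_∈ E) (sym (trans (cong (_⊞ d) (⊟-⊞ x)) (//-rightDividesˡ d (⊟ x)))) -x∈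
        where
        ⊟-⊞ : ∀ x → ⊟ (x ⊞ d) ≡ ⊟ x ⊞ ⊟ d
        ⊟-⊞ x = trans (⁻¹-anti-homo-∙ x d) (⊞-comm (⊟ d) (⊟ x))
      ... | no -x∉ = ⊥-elim (x∉ (∈-setOf⁺ inN? -x∉))

    N⊕A⊆ : N ⊕ A ⊆ -B
    N⊕A⊆ z∈ with n , a , n∈ , a∈ , refl ← ∈-⊕⁻ z∈ = ∈-setOf⁺ in-B? λ -z∈ →
      ∈-setOf⁻ inN? n∈ (subst (_∈ E)
        (trans (cong (a ⊞_) (⁻¹-anti-homo-∙ n a))
          (trans (sym (⊞-assoc a _ _)) (trans (cong (_⊞ ⊟ n) (⊞-inverseʳ a)) (⊞-identityˡ _))))
        (∈-⊕⁺ a∈ -z∈))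

    N⊕A≤ : ∣ N ⊕ A ∣ ≤ p ∸ ∣ B ∣
    N⊕A≤ = ≤-trans (p⊆q⇒∣p∣≤∣q∣ N⊕A⊆) (subst (∣ -B ∣ ≤_) (∣∁p∣≡n∸∣p∣ B)
      (injective⇒∣∣≤ ⊟_ -B (∁ B) (λ _ _ → ⊟-injective) (λ x∈ → x∉p⇒x∈∁p (∈-setOf⁻ in-B? x∈))))

    <p : p ∸ ∣ B ∣ < p
    <p = ∸-monoʳ-< (x∈p⇒1≤∣p∣ b∈) (∣p∣≤n B)

    tightN : suc ∣ N ⊕ A ∣ ≤ ∣ N ∣ + ∣ A ∣
    tightN = ≤-trans (s≤s N⊕A≤) (≤-trans (+-cancelʳ-≤ (∣ B ∣ + ∣ E ∣) _ _ (begin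
      suc (p ∸ ∣ B ∣) + (∣ B ∣ + ∣ E ∣)            ≡⟨ cong suc (sym (+-assoc (p ∸ ∣ B ∣) _ _)) ⟩
      suc (p ∸ ∣ B ∣ + ∣ B ∣ + ∣ E ∣)              ≡⟨ cong (λ n → suc (n + ∣ E ∣)) (m∸n+n≡m (∣p∣≤n B)) ⟩
      suc (p + ∣ E ∣)                              ≡⟨ +-suc p ∣ E ∣ ⟨
      p + suc ∣ E ∣                                ≤⟨ +-monoʳ-≤ p tight ⟩
      p + (∣ A ∣ + ∣ B ∣)                          ≡⟨ cong (_+ (∣ A ∣ + ∣ B ∣)) (m∸n+n≡m (∣p∣≤n E)) ⟨
      p ∸ ∣ E ∣ + ∣ E ∣ + (∣ A ∣ + ∣ B ∣)          ≡⟨ rearrange (p ∸ ∣ E ∣) (∣ E ∣) (∣ A ∣) (∣ B ∣) ⟩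
      p ∸ ∣ E ∣ + ∣ A ∣ + (∣ B ∣ + ∣ E ∣)          ∎)) (+-monoˡ-≤ ∣ A ∣ p∸E≤N))
      where
      open ≤-Reasoning
      open +-*-Solver
      rearrange : ∀ q e a b → q + e + (a + b) ≡ q + a + (b + e)
      rearrange = solve 4 (λ q e a b → q :+ e :+ (a :+ b) := q :+ a :+ (b :+ e)) refl

  pair⇒AP : ∀ B → 2 ≤ ∣ B ∣ → ∣ B ∣ ≤ 2 → ∃ λ d → toℕ d ≢ 0 × AP d B
  pair⇒AP B 2≤ ≤2 with b , b′ , b∈ , b′∈ , b≢b′ ← 2≤∣p∣⇒distinct B 2≤ =
    b′ ⊖ b , ⊖≢0 (b≢b′ ∘ sym) , b , 2 , λ x → mk⇔ (into x)
      (λ { (zero , _ , refl) → subst (_∈ B) (sym (el-zero b (b′ ⊖ b))) b∈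
         ; (suc zero , _ , refl) → subst (_∈ B) (sym (el-one)) b′∈
         ; (suc (suc _) , s≤s (s≤s ()) , _) })
    where
    el-one : el b (b′ ⊖ b) 1 ≡ b′
    el-one = trans (el-suc b _ 0) (trans (cong (_⊞ (b′ ⊖ b)) (el-zero b (b′ ⊖ b))) (trans (⊞-comm b (b′ ⊖ b)) (//-rightDividesˡ b b′)))
    into : ∀ x → x ∈ B → ∃ λ i → i < 2 × x ≡ el b (b′ ⊖ b) i
    into x x∈ with x Fin.≟ b | x Fin.≟ b′
    ... | yes refl | _ = 0 , s≤s z≤n , sym (el-zero b (b′ ⊖ b))
    ... | no _ | yes refl = 1 , s≤s (s≤s z≤n) , sym el-one
    ... | no x≢b | no x≢b′ = ⊥-elim (<⇒≱ (≤-<-trans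
            (distinct⇒2≤∣p∣ (x∈p∧x≢y⇒x∈p-y b∈ (x≢b ∘ sym)) (x∈p∧x≢y⇒x∈p-y b′∈ (x≢b′ ∘ sym)) b≢b′)
            (x∈p⇒∣p-x∣<∣p∣ x∈)) ≤2)

  module _ {A B : Subset p} (2≤A : 2 ≤ ∣ A ∣) (3≤B : 3 ≤ ∣ B ∣)
           (tight : suc ∣ A ⊕ B ∣ ≤ ∣ A ∣ + ∣ B ∣) (<p : ∣ A ⊕ B ∣ < p)
           (none : ∀ e → 2 ≤ ∣ Transform.Bₑ A B e ∣ → ∣ B ∣ ≤ ∣ Transform.Bₑ A B e ∣) where

    private
      nonempty-B = 1≤∣p∣⇒nonempty B (≤-trans (s≤s z≤n) 3≤B)
      b₀ = proj₁ nonempty-B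
      b₀∈ = proj₂ nonempty-B

      module At (a : Fin p) = Transform A B (a ⊖ b₀)

      -- `X` consists of the `a` in `A` for which the shift by `a ⊖ b₀` sends all of `B` into `A`.
      -- For any other `a` in `A`, the hypothesis `none` leaves `b₀` as the only point of the
      -- transformed `B`.
      inX? : ∀ a → Dec (a ∈ A × ∣ B ∣ ≤ ∣ At.Bₑ a ∣)
      inX? a = (a ∈? A) ×-dec (∣ B ∣ ≤? ∣ At.Bₑ a ∣)
      X = setOf inX?

      b₀+e : ∀ a → b₀ ⊞ (a ⊖ b₀) ≡ a
      b₀+e a = trans (⊞-comm b₀ _) (//-rightDividesˡ b₀ a)

      X⊕B≤A : ∣ X ⊕ B ∣ ≤ ∣ A ∣
      X⊕B≤A = injective⇒∣∣≤ (_⊖ b₀) (X ⊕ B) A (λ _ _ → ∙-cancelʳ (⊟ b₀) _ _) mem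
        where
        mem : ∀ {z} → z ∈ X ⊕ B → z ⊖ b₀ ∈ A
        mem z∈ with a , b , a∈ , b∈ , refl ← ∈-⊕⁻ z∈ =
          subst (_∈ A) (trans (x∙yz≈y∙xz b a _) (sym (⊞-assoc a b _)))
            (At.Bₑ+e⊆A a (⊆∧∣∣≥⇒⊇ (At.Bₑ⊆B a) (proj₂ (∈-setOf⁻ inX? a∈)) b∈))

      -- For nonempty `X`, a translate of `X ⊕ B` lies in `A`, so Cauchy-Davenport gives
      -- `∣ X ∣ + ∣ B ∣ ≤ ∣ A ∣ + 1`; here `∣ B ∣ ≥ 3` leaves two elements of `A` outside `X`.
      2+X≤A : 2 + ∣ X ∣ ≤ ∣ A ∣
      2+X≤A with nonempty? X
      ... | no empty = subst (λ n → 2 + n ≤ ∣ A ∣) (sym (trans (cong ∣_∣ (Empty-unique empty)) (∣⊥∣≡0 p))) 2≤A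
      ... | yes ne = ≤-pred (begin
        3 + ∣ X ∣           ≡⟨ +-comm 3 ∣ X ∣ ⟩
        ∣ X ∣ + 3           ≤⟨ +-monoʳ-≤ ∣ X ∣ 3≤B ⟩
        ∣ X ∣ + ∣ B ∣       ≤⟨ cauchyDavenport X B ne nonempty-B (≤-<-trans X⊕B≤A (≤-<-trans (∣A∣≤∣A⊕B∣ A B nonempty-B) <p)) ⟩
        suc ∣ X ⊕ B ∣       ≤⟨ s≤s X⊕B≤A ⟩
        suc ∣ A ∣           ∎)
        where open ≤-Reasoning

      2≤A─X : 2 ≤ ∣ A ─ X ∣
      2≤A─X = +-cancelˡ-≤ ∣ X ∣ 2 _ (begin
        ∣ X ∣ + 2                              ≡⟨ +-comm ∣ X ∣ 2 ⟩
        2 + ∣ X ∣                              ≤⟨ 2+X≤A ⟩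
        ∣ A ∣                                  ≤⟨ p⊆q⇒∣p∣≤∣q∣ cover ⟩
        ∣ X ∪ (A ─ X) ∣                        ≤⟨ m≤m+n _ _ ⟩
        ∣ X ∪ (A ─ X) ∣ + ∣ X ∩ (A ─ X) ∣      ≡⟨ ∣∪∣+∣∩∣ X (A ─ X) ⟩
        ∣ X ∣ + ∣ A ─ X ∣                      ∎)
        where
        open ≤-Reasoning
        cover : A ⊆ X ∪ (A ─ X)
        cover {x} x∈ with x ∈? X
        ... | yes x∈X = x∈p∪q⁺ (inj₁ x∈X)
        ... | no  x∉X = x∈p∪q⁺ (inj₂ (x∈p∧x∉q⇒x∈p─q x∈ x∉X))

      -- `G` is `A ⊕ B` translated by `⊟ b₀`, a common container for the enlarged sets `Aₑ` of all
      -- `a` in `A`.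
      inG? : ∀ x → Dec (x ⊞ b₀ ∈ A ⊕ B)
      inG? x = x ⊞ b₀ ∈? A ⊕ B
      G = setOf inG?

      Aₑ⊆G : ∀ {a} → a ∈ A → At.Aₑ a ⊆ G
      Aₑ⊆G {a} a∈ {x} x∈ with ∈-setOf⁻ (At.inA? a) x∈
      ... | inj₁ x∈A = ∈-setOf⁺ inG? (∈-⊕⁺ x∈A b₀∈)
      ... | inj₂ x-e∈B = ∈-setOf⁺ inG? (subst (_∈ A ⊕ B) eq (∈-⊕⁺ a∈ x-e∈B))
        where
        open ≡-Reasoning
        eq : a ⊞ (x ⊖ (a ⊖ b₀)) ≡ x ⊞ b₀
        eq = begin
          a ⊞ (x ⊖ (a ⊖ b₀))                  ≡⟨ cong (_⊞ (x ⊖ (a ⊖ b₀))) (b₀+e a) ⟨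
          (b₀ ⊞ (a ⊖ b₀)) ⊞ (x ⊖ (a ⊖ b₀))    ≡⟨ ⊞-assoc b₀ _ _ ⟩
          b₀ ⊞ ((a ⊖ b₀) ⊞ (x ⊖ (a ⊖ b₀)))    ≡⟨ cong (b₀ ⊞_) (trans (⊞-comm (a ⊖ b₀) _) (//-rightDividesˡ (a ⊖ b₀) x)) ⟩
          b₀ ⊞ x                              ≡⟨ ⊞-comm b₀ x ⟩
          x ⊞ b₀                              ∎

      module _ {a : Fin p} (a∈ : a ∈ A ─ X) where
        a∈A : a ∈ A
        a∈A = p─q⊆p A X a∈

        Bₑ≤1 : ∣ At.Bₑ a ∣ ≤ 1
        Bₑ≤1 = ≮⇒≥ λ 2≤ → x∈p─q⇒x∉q A X a∈ (∈-setOf⁺ inX? (a∈A , none _ 2≤))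

        -- The transform loses nothing of `∣ A ∣ + ∣ B ∣` while `Bₑ` has at most one point, so
        -- tightness makes `Aₑ` as large as `G`.
        G⊆Aₑ : G ⊆ At.Aₑ a
        G⊆Aₑ = ⊆∧∣∣≥⇒⊇ (Aₑ⊆G a∈A) (≤-pred (begin
          suc ∣ G ∣                       ≤⟨ s≤s (injective⇒∣∣≤ (_⊞ b₀) G (A ⊕ B) (λ _ _ → ∙-cancelʳ b₀ _ _) (∈-setOf⁻ inG?)) ⟩
          suc ∣ A ⊕ B ∣                   ≤⟨ tight ⟩
          ∣ A ∣ + ∣ B ∣                   ≤⟨ At.∣A∣+∣B∣≤ a ⟩
          ∣ At.Aₑ a ∣ + ∣ At.Bₑ a ∣       ≤⟨ +-monoʳ-≤ _ Bₑ≤1 ⟩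
          ∣ At.Aₑ a ∣ + 1                 ≡⟨ +-comm _ 1 ⟩
          suc ∣ At.Aₑ a ∣                 ∎))
          where open ≤-Reasoning

        b+e∉A : ∀ {b} → b ∈ B → b ≢ b₀ → b ⊞ (a ⊖ b₀) ∉ A
        b+e∉A b∈ b≢b₀ b+e∈ = <⇒≱ (distinct⇒2≤∣p∣ (At.∈Bₑ a b∈ b+e∈)
          (At.∈Bₑ a b₀∈ (subst (_∈ A) (sym (b₀+e a)) a∈A)) b≢b₀) Bₑ≤1

      -- For either element, `G` is the disjoint union of `A` and the translate of `B - b₀` by
      -- `a ⊖ b₀`. The translates for `a` and `a′` are therefore the same set, the part of `G`
      -- outside `A`.
      closed : ∀ {a a′} → a ∈ A ─ X → a′ ∈ A ─ X → ∀ {b} → b ∈ B - b₀ → b ⊞ ((a ⊖ b₀) ⊖ (a′ ⊖ b₀)) ∈ B - b₀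
      closed {a} {a′} a∈ a′∈ {b} b∈* with ∈-setOf⁻ (At.inA? a′) (G⊆Aₑ a′∈ (Aₑ⊆G (a∈A a∈) (At.B+e⊆Aₑ a b∈)))
        where
        b∈ = p─q⊆p B ⁅ b₀ ⁆ b∈*
      ... | inj₁ b+e∈A = ⊥-elim (b+e∉A a∈ (p─q⊆p B ⁅ b₀ ⁆ b∈*) (λ { refl → x∉p-x B b₀ b∈* }) b+e∈A)
      ... | inj₂ ∈B = x∈p∧x≢y⇒x∈p-y (subst (_∈ B) (⊞-assoc b _ _) ∈B) λ e →
        b+e∉A a∈ (p─q⊆p B ⁅ b₀ ⁆ b∈*) (λ { refl → x∉p-x B b₀ b∈* }) (subst (_∈ A) (eq e) (a∈A a′∈))
        where
        t = (a ⊖ b₀) ⊖ (a′ ⊖ b₀)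
        eq : b ⊞ t ≡ b₀ → a′ ≡ b ⊞ (a ⊖ b₀)
        eq e = begin
          a′                              ≡⟨ b₀+e a′ ⟨
          b₀ ⊞ (a′ ⊖ b₀)                  ≡⟨ cong (_⊞ (a′ ⊖ b₀)) e ⟨
          (b ⊞ t) ⊞ (a′ ⊖ b₀)             ≡⟨ ⊞-assoc b t _ ⟩
          b ⊞ (t ⊞ (a′ ⊖ b₀))             ≡⟨ cong (b ⊞_) (//-rightDividesˡ (a′ ⊖ b₀) (a ⊖ b₀)) ⟩
          b ⊞ (a ⊖ b₀)                    ∎
          where open ≡-Reasoning

    -- Two elements of A whose transform shrinks B to a point would make B ∖ {b₀} periodic.
    transform-exists : Absurd
    transform-exists = impossible (2≤∣p∣⇒distinct (A ─ X) 2≤A─X)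
      where
      impossible : (∃₂ λ a a′ → a ∈ A ─ X × a′ ∈ A ─ X × a ≢ a′) → Absurd
      impossible (a , a′ , a∈ , a′∈ , a≢a′) =
        let b , b∈ , b≢b₀ = another B (≤-trans (s≤s (s≤s z≤n)) 3≤B) b₀
        in x∉p-x B b₀ (closed⇒full (⊖≢0 (a≢a′ ∘ ∙-cancelʳ (⊟ b₀) a a′))
             (b , x∈p∧x≢y⇒x∈p-y b∈ b≢b₀) (closed a∈ a′∈) b₀)

  -- Induction on `∣ B ∣`, by transforms that keep at least two points of `B`. The transformed pair
  -- supplies `d` but says nothing directly about `A`. Since both pairs are tight, `Aₑ ⊕ Bₑ` is all
  -- of `A ⊕ B`, which therefore has at most one start, and `OneStart-⊕⇒AP` returns from the sumset
  -- to `A`.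
  vosper : ∀ A B → 2 ≤ ∣ A ∣ → 2 ≤ ∣ B ∣ → suc ∣ A ⊕ B ∣ ≤ ∣ A ∣ + ∣ B ∣ → 2 + ∣ A ⊕ B ∣ ≤ p →
    ∃ λ d → toℕ d ≢ 0 × AP d A × AP d B
  vosper A B = go ∣ B ∣ A B ≤-refl
    where
    go : ∀ n A B → ∣ B ∣ ≤ n → 2 ≤ ∣ A ∣ → 2 ≤ ∣ B ∣ → suc ∣ A ⊕ B ∣ ≤ ∣ A ∣ + ∣ B ∣ → 2 + ∣ A ⊕ B ∣ ≤ p →
      ∃ λ d → toℕ d ≢ 0 × AP d A × AP d B
    go zero A B B≤ 2≤A 2≤B tight small = ⊥-elim (<⇒≱ (≤-trans (s≤s z≤n) 2≤B) B≤)
    go (suc n) A B B≤ 2≤A 2≤B tight small with ∣ B ∣ ≤? 2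
    ... | yes B≤2 =
      let d , d≢0 , apB = pair⇒AP B 2≤B B≤2 in
      d , d≢0 , AP-transfer d≢0 apB 2≤B (1≤∣p∣⇒nonempty A (≤-trans (s≤s z≤n) 2≤A))
        (subst (λ S → ∣ S ∣ < p) (⊕-comm A B) (<⇒≤ small))
        (subst₂ _≤_ (cong (suc ∘ ∣_∣) (⊕-comm A B)) (+-comm ∣ A ∣ ∣ B ∣) tight) , apB
    ... | no B≰2 with any? (λ e → (2 ≤? ∣ Transform.Bₑ A B e ∣) ×-dec (∣ Transform.Bₑ A B e ∣ <? ∣ B ∣))
    ...   | no none = ⊥-elim (transform-exists 2≤A (≰⇒> B≰2) tight (<⇒≤ small) (λ e 2≤ → ≮⇒≥ λ < → none (e , 2≤ , <)))
    ...   | yes (e , 2≤Bₑ , Bₑ<B) =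
      let tightₑ = ≤-trans (s≤s (p⊆q⇒∣p∣≤∣q∣ Aₑ⊕Bₑ⊆A⊕B)) (≤-trans tight ∣A∣+∣B∣≤)
          smallₑ = ≤-trans (s≤s (s≤s (p⊆q⇒∣p∣≤∣q∣ Aₑ⊕Bₑ⊆A⊕B))) small
          2≤Aₑ = ≤-trans 2≤A (p⊆q⇒∣p∣≤∣q∣ A⊆Aₑ)
          d , d≢0 , apAₑ , apBₑ = go n Aₑ Bₑ (≤-pred (≤-trans Bₑ<B B≤)) 2≤Aₑ 2≤Bₑ tightₑ smallₑ
          ne : ∀ {S : Subset p} → 2 ≤ ∣ S ∣ → Nonempty S
          ne {S} 2≤ = 1≤∣p∣⇒nonempty S (≤-trans (s≤s z≤n) 2≤)
          A⊕B⊆ = ⊆∧∣∣≥⇒⊇ Aₑ⊕Bₑ⊆A⊕B (≤-pred (≤-trans tight (≤-trans ∣A∣+∣B∣≤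
                   (cauchyDavenport Aₑ Bₑ (ne 2≤Aₑ) (ne 2≤Bₑ) (<⇒≤ smallₑ)))))
          one = subst (OneStart d) (⊆-antisym Aₑ⊕Bₑ⊆A⊕B A⊕B⊆) (⊕-OneStart apAₑ apBₑ)
          apA = OneStart-⊕⇒AP d≢0 (ne 2≤A) (ne 2≤B) tight small one
      in d , d≢0 , apA , AP-transfer d≢0 apA 2≤A (ne 2≤B) (<⇒≤ small) tight
      where open Transform A B e

-- Sumsets of lists and the equality case

∈-∃↭ : ∀ {A : Set} {x : A} {xs} → x ∈ₗ xs → ∃ λ ys → xs ↭ x ∷ ys
∈-∃↭ {x = x} x∈ with ys , zs , refl ← ∈-∃++ x∈ = ys ++ zs , shift x ys zs

Big : ∀ {n} → Subset n → Set
Big B = 2 ≤ ∣ B ∣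

Big⇒Nonempty : ∀ {n} {B : Subset n} → Big B → Nonempty B
Big⇒Nonempty {B = B} 2≤ = 1≤∣p∣⇒nonempty B (≤-trans (s≤s z≤n) 2≤)

size : ∀ {n} → List (Subset n) → ℕ
size L = sum (map ∣_∣ L)

module ListSumsets (p : ℕ) .{{_ : NonZero p}} (pr : Prime p) where
  open VosperTheorem p pr public

  sumset : List (Subset p) → Subset p
  sumset []      = ⁅ 0ₚ ⁆
  sumset (B ∷ L) = B ⊕ sumset L

  sumset-↭ : ∀ {L L′} → L ↭ L′ → sumset L ≡ sumset L′
  sumset-↭ refl = refl
  sumset-↭ (prep B L↭) = cong (B ⊕_) (sumset-↭ L↭)
  sumset-↭ {B ∷ C ∷ L} {C ∷ B ∷ L′} (swap B C L↭) = begin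
    B ⊕ C ⊕ sumset L      ≡⟨ ⊕-assoc B C _ ⟨
    (B ⊕ C) ⊕ sumset L    ≡⟨ cong₂ _⊕_ (⊕-comm B C) (sumset-↭ L↭) ⟩
    (C ⊕ B) ⊕ sumset L′   ≡⟨ ⊕-assoc C B _ ⟩
    C ⊕ B ⊕ sumset L′     ∎
    where open ≡-Reasoning
  sumset-↭ (transitive L↭ L↭′) = trans (sumset-↭ L↭) (sumset-↭ L↭′)

  sumset-nonempty : ∀ {L} → All Big L → Nonempty (sumset L)
  sumset-nonempty [] = 0ₚ , x∈⁅x⁆ 0ₚ
  sumset-nonempty (b ∷ bs) = ⊕-nonempty (Big⇒Nonempty b) (sumset-nonempty bs)

  ∣B∣≤∣A⊕B∣ : ∀ A B → Nonempty A → ∣ B ∣ ≤ ∣ A ⊕ B ∣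
  ∣B∣≤∣A⊕B∣ A B ne = subst (λ S → ∣ B ∣ ≤ ∣ S ∣) (⊕-comm B A) (∣A∣≤∣A⊕B∣ B A ne)

  cauchyDavenport-list : ∀ {L} → All Big L → ∣ sumset L ∣ < p → suc (size L) ≤ ∣ sumset L ∣ + length L
  cauchyDavenport-list [] _ = ≤-reflexive (trans (sym (∣⁅x⁆∣≡1 0ₚ)) (sym (+-identityʳ _)))
  cauchyDavenport-list {B ∷ L} (b ∷ bs) <p = begin
    suc (∣ B ∣ + size L)                  ≡⟨ +-suc ∣ B ∣ (size L) ⟨
    ∣ B ∣ + suc (size L)                  ≤⟨ +-monoʳ-≤ ∣ B ∣ (cauchyDavenport-list bs (≤-<-trans (∣B∣≤∣A⊕B∣ B _ (Big⇒Nonempty b)) <p)) ⟩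
    ∣ B ∣ + (∣ sumset L ∣ + length L)     ≡⟨ +-assoc ∣ B ∣ _ _ ⟨
    ∣ B ∣ + ∣ sumset L ∣ + length L       ≤⟨ +-monoˡ-≤ (length L) (cauchyDavenport B _ (Big⇒Nonempty b) (sumset-nonempty bs) <p) ⟩
    suc (∣ B ⊕ sumset L ∣ + length L)     ≡⟨ +-suc _ (length L) ⟨
    ∣ B ⊕ sumset L ∣ + suc (length L)     ∎
    where open ≤-Reasoning

  -- `tight` is the reverse of the inequality in `cauchyDavenport-list`, so this is its equality
  -- case. All fields are symmetric in the members, which lets any two be moved to the front.
  record Critical (L : List (Subset p)) : Set where
    field
      big   : All Big L
      <p    : ∣ sumset L ∣ < p
      tight : ∣ sumset L ∣ + length L ≤ suc (size L)

  Critical-↭ : ∀ {L L′} → L ↭ L′ → Critical L → Critical L′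
  Critical-↭ L↭ crit = record
    { big   = All-resp-↭ L↭ big
    ; <p    = subst (λ S → ∣ S ∣ < p) (sumset-↭ L↭) <p
    ; tight = subst₂ _≤_ (cong₂ _+_ (cong ∣_∣ (sumset-↭ L↭)) (↭-length L↭)) (cong suc (sum-↭ (map⁺ ∣_∣ L↭))) tight }
    where open Critical crit

  module _ {B C L} (crit : Critical (B ∷ C ∷ L)) where
    open Critical crit

    private
      bigB = All.head big
      bigC = All.head (All.tail big)
      bigL = All.tail (All.tail big)

      ⊕-sumset : (B ⊕ C) ⊕ sumset L ≡ sumset (B ∷ C ∷ L)
      ⊕-sumset = ⊕-assoc B C (sumset L)

      <p′ : ∣ (B ⊕ C) ⊕ sumset L ∣ < p
      <p′ = subst (λ S → ∣ S ∣ < p) (sym ⊕-sumset) <p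

      nonempty : Nonempty (B ⊕ C)
      nonempty = ⊕-nonempty (Big⇒Nonempty bigB) (Big⇒Nonempty bigC)

    ∣B⊕C∣≤ : ∣ B ⊕ C ∣ ≤ ∣ sumset (B ∷ C ∷ L) ∣
    ∣B⊕C∣≤ = subst (λ S → ∣ B ⊕ C ∣ ≤ ∣ S ∣) ⊕-sumset (∣A∣≤∣A⊕B∣ (B ⊕ C) _ (sumset-nonempty bigL))

    ∣B⊕C∣+ : ∣ B ⊕ C ∣ + ∣ sumset L ∣ ≤ suc ∣ sumset (B ∷ C ∷ L) ∣
    ∣B⊕C∣+ = subst (λ S → ∣ B ⊕ C ∣ + ∣ sumset L ∣ ≤ suc ∣ S ∣) ⊕-sumset
      (cauchyDavenport (B ⊕ C) (sumset L) nonempty (sumset-nonempty bigL) <p′)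

    -- Cauchy-Davenport for the remaining members, and for joining them to `B ⊕ C`, uses up the
    -- tightness of the whole list, so the pair has no slack of its own.
    pair-tight : suc ∣ B ⊕ C ∣ ≤ ∣ B ∣ + ∣ C ∣
    pair-tight = +-cancelʳ-≤ (size L) _ _ (begin
      suc ∣ B ⊕ C ∣ + size L                    ≡⟨ +-suc ∣ B ⊕ C ∣ (size L) ⟨
      ∣ B ⊕ C ∣ + suc (size L)                  ≤⟨ +-monoʳ-≤ ∣ B ⊕ C ∣ (cauchyDavenport-list bigL (≤-<-trans (∣B∣≤∣A⊕B∣ (B ⊕ C) _ nonempty) <p′)) ⟩
      ∣ B ⊕ C ∣ + (∣ sumset L ∣ + length L)     ≡⟨ +-assoc ∣ B ⊕ C ∣ _ _ ⟨
      ∣ B ⊕ C ∣ + ∣ sumset L ∣ + length L       ≤⟨ +-monoˡ-≤ (length L) ∣B⊕C∣+ ⟩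
      suc (∣ sumset (B ∷ C ∷ L) ∣ + length L)   ≤⟨ ≤-pred (≤-trans (≤-reflexive (sym (trans (+-suc _ _) (cong suc (+-suc _ _))))) tight) ⟩
      ∣ B ∣ + (∣ C ∣ + size L)                  ≡⟨ +-assoc ∣ B ∣ _ _ ⟨
      ∣ B ∣ + ∣ C ∣ + size L                    ∎)
      where open ≤-Reasoning

    pair-transfer : ∀ {d} → toℕ d ≢ 0 → AP d B → AP d C
    pair-transfer d≢0 apB = AP-transfer d≢0 apB bigB (Big⇒Nonempty bigC) (≤-<-trans ∣B⊕C∣≤ <p) pair-tight

    head-AP : 2 + ∣ sumset (B ∷ C ∷ L) ∣ ≤ p ⊎ 1 ≤ length L → ∃ λ d → toℕ d ≢ 0 × AP d B
    head-AP small = let d , d≢0 , apB , _ = vosper B C bigB bigC pair-tight (small-pair bigL small) in d , d≢0 , apB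
      where
      small-pair : All Big L → 2 + ∣ sumset (B ∷ C ∷ L) ∣ ≤ p ⊎ 1 ≤ length L → 2 + ∣ B ⊕ C ∣ ≤ p
      small-pair _ (inj₁ small) = ≤-trans (s≤s (s≤s ∣B⊕C∣≤)) small
      small-pair (_∷_ {D} {L′} bigD bigL′) (inj₂ _) = begin
        2 + ∣ B ⊕ C ∣                   ≡⟨ +-comm 2 _ ⟩
        ∣ B ⊕ C ∣ + 2                   ≤⟨ +-monoʳ-≤ ∣ B ⊕ C ∣ (≤-trans bigD (∣A∣≤∣A⊕B∣ D (sumset L′) (sumset-nonempty bigL′))) ⟩
        ∣ B ⊕ C ∣ + ∣ sumset L ∣        ≤⟨ ∣B⊕C∣+ ⟩
        suc ∣ sumset (B ∷ C ∷ L) ∣      ≤⟨ <p ⟩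
        p                               ∎
        where open ≤-Reasoning

  AP-all : ∀ {d B L} → toℕ d ≢ 0 → Critical L → B ∈ₗ L → AP d B → All (AP d) L
  AP-all {d} {B} {L} d≢0 crit B∈L apB with L′ , L↭ ← ∈-∃↭ B∈L =
    All-resp-↭ (↭-sym L↭) (apB ∷ All.tabulate λ C∈L′ →
      let L″ , L′↭ = ∈-∃↭ C∈L′
      in pair-transfer (Critical-↭ (↭-trans L↭ (prep B L′↭)) crit) d≢0 apB)

-- Multiplicities and uncrossing along a list

χ-∈ : ∀ {n} {B : Subset n} {x} → x ∈ B → χ B x ≡ 1
χ-∈ x∈ = cong (λ b → if b then 1 else 0) ([]=⇒lookup x∈)

χ-∉ : ∀ {n} {B : Subset n} {x} → x ∉ B → χ B x ≡ 0
χ-∉ {B = B} {x} x∉ with lookup B x in eq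
... | true  = ⊥-elim (x∉ (lookup⇒[]= x B eq))
... | false = refl

χ≤1 : ∀ {n} (B : Subset n) x → χ B x ≤ 1
χ≤1 B x with lookup B x
... | true  = ≤-refl
... | false = z≤n

χ-∪∩ : ∀ {n} (A B : Subset n) x → χ (A ∪ B) x + χ (A ∩ B) x ≡ χ A x + χ B x
χ-∪∩ A B x rewrite lookup-zipWith _∨_ x A B | lookup-zipWith _∧_ x A B with lookup A x | lookup B x
... | true  | true  = refl
... | true  | false = refl
... | false | true  = refl
... | false | false = refl

mult : ∀ {n} → List (Subset n) → Fin n → ℕ
mult L x = sum (map (λ B → χ B x) L)

mult-↭ : ∀ {n} {L L′ : List (Subset n)} → L ↭ L′ → ∀ x → mult L x ≡ mult L′ x
mult-↭ L↭ x = sum-↭ (map⁺ (λ B → χ B x) L↭)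

mult≤length : ∀ {n} (L : List (Subset n)) x → mult L x ≤ length L
mult≤length []      x = z≤n
mult≤length (B ∷ L) x = +-mono-≤ (χ≤1 B x) (mult≤length L x)

All-∈⇒length≤mult : ∀ {n} {L : List (Subset n)} {x} → All (x ∈_) L → length L ≤ mult L x
All-∈⇒length≤mult []        = z≤n
All-∈⇒length≤mult (x∈ ∷ xs) = +-mono-≤ (≤-reflexive (sym (χ-∈ x∈))) (All-∈⇒length≤mult xs)

length≤mult⇒All-∈ : ∀ {n} (L : List (Subset n)) {x} → length L ≤ mult L x → All (x ∈_) L
length≤mult⇒All-∈ []      _ = []
length≤mult⇒All-∈ (B ∷ L) {x} len≤ with x ∈? B
... | yes x∈ = x∈ ∷ length≤mult⇒All-∈ L (≤-pred (≤-trans len≤ (≤-reflexive (cong (_+ mult L x) (χ-∈ x∈)))))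
... | no  x∉ = ⊥-elim (<⇒≱ (s≤s (mult≤length L x)) (≤-trans len≤ (≤-reflexive (cong (_+ mult L x) (χ-∉ x∉)))))

∈⇒1≤mult : ∀ {n} {L : List (Subset n)} {B x} → B ∈ₗ L → x ∈ B → 1 ≤ mult L x
∈⇒1≤mult (here refl) x∈ = ≤-trans (≤-reflexive (sym (χ-∈ x∈))) (m≤m+n _ _)
∈⇒1≤mult (there B∈)  x∈ = ≤-trans (∈⇒1≤mult B∈ x∈) (m≤n+m _ _)

1≤mult⇒∈ : ∀ {n} (L : List (Subset n)) {x} → 1 ≤ mult L x → ∃ λ B → B ∈ₗ L × x ∈ B
1≤mult⇒∈ (B ∷ L) {x} 1≤ with x ∈? B
... | yes x∈ = B , here refl , x∈
... | no  x∉ with C , C∈ , x∈ ← 1≤mult⇒∈ L (≤-trans 1≤ (≤-reflexive (cong (_+ mult L x) (χ-∉ x∉)))) = C , there C∈ , x∈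

-- Uncrossing C in turn with the members of a list; meet C L is what finally remains of C.
bubble : ∀ {n} → Subset n → List (Subset n) → List (Subset n)
bubble C []      = []
bubble C (A ∷ L) = (A ∪ C) ∷ bubble (A ∩ C) L

meet : ∀ {n} → Subset n → List (Subset n) → Subset n
meet C []      = C
meet C (A ∷ L) = meet (A ∩ C) L

length-bubble : ∀ {n} (C : Subset n) L → length (bubble C L) ≡ length L
length-bubble C []      = refl
length-bubble C (A ∷ L) = cong suc (length-bubble (A ∩ C) L)

Big-∪ : ∀ {n} (A C : Subset n) → Big A → Big (A ∪ C)
Big-∪ A C bigA = ≤-trans bigA (∣p∣≤∣p∪q∣ A C)

Big-bubble : ∀ {n} (C : Subset n) {L} → All Big L → All Big (bubble C L)
Big-bubble C [] = []
Big-bubble C (_∷_ {A} b bs) = Big-∪ A C b ∷ Big-bubble (A ∩ C) bs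

meet⊆ : ∀ {n} (C : Subset n) L → meet C L ⊆ C
meet⊆ C []      x∈ = x∈
meet⊆ C (A ∷ L) x∈ = p∩q⊆q A C (meet⊆ (A ∩ C) L x∈)

∈-meet⇒All : ∀ {n} (C : Subset n) L {x} → x ∈ meet C L → All (x ∈_) L
∈-meet⇒All C []      x∈ = []
∈-meet⇒All C (A ∷ L) x∈ = p∩q⊆p A C (meet⊆ (A ∩ C) L x∈) ∷ ∈-meet⇒All (A ∩ C) L x∈

∈-meet⇒All-bubble : ∀ {n} (C : Subset n) L {x} → x ∈ meet C L → All (x ∈_) (bubble C L)
∈-meet⇒All-bubble C []      x∈ = []
∈-meet⇒All-bubble C (A ∷ L) x∈ = q⊆p∪q A C (p∩q⊆q A C (meet⊆ (A ∩ C) L x∈)) ∷ ∈-meet⇒All-bubble (A ∩ C) L x∈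

∈-meet⇒length≤mult : ∀ {n} (C : Subset n) L {x} → x ∈ meet C L → suc (length L) ≤ mult (C ∷ L) x
∈-meet⇒length≤mult C L x∈ = All-∈⇒length≤mult {L = C ∷ L} (meet⊆ C L x∈ ∷ ∈-meet⇒All C L x∈)

-- Sumsets and multiplicities of shrinking families

module Uncrossing (p : ℕ) .{{_ : NonZero p}} (pr : Prime p) where
  open ListSumsets p pr public

  -- Choosing increasing indices becomes a walk along the list that skips or takes each member, so
  -- permutation and uncrossing are settled by cases on the first two members.
  data InΣ : ℕ → List (Subset p) → Fin p → Set where
    done : InΣ 0 [] 0ₚ
    skip : ∀ {k A L x} → InΣ k L x → InΣ k (A ∷ L) x
    take : ∀ {k A L a x} → a ∈ A → InΣ k L x → InΣ (suc k) (A ∷ L) (a ⊞ x)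

  sumset⇒InΣ : ∀ L {x} → x ∈ sumset L → InΣ (length L) L x
  sumset⇒InΣ [] x∈ = subst (InΣ 0 []) (sym (x∈⁅y⁆⇒x≡y 0ₚ x∈)) done
  sumset⇒InΣ (B ∷ L) x∈ with b , y , b∈ , y∈ , refl ← ∈-⊕⁻ x∈ = take b∈ (sumset⇒InΣ L y∈)

  take₂ : ∀ {k A B L a b x} → b ∈ A → a ∈ B → InΣ k L x → InΣ (suc (suc k)) (A ∷ B ∷ L) (a ⊞ (b ⊞ x))
  take₂ {A = A} {B} {L} {a} {b} b∈ a∈ s =
    subst (InΣ _ (A ∷ B ∷ L)) (x∙yz≈y∙xz b a _) (take b∈ (take a∈ s))

  InΣ-↭ : ∀ {k L L′ x} → L ↭ L′ → InΣ k L x → InΣ k L′ x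
  InΣ-↭ refl s = s
  InΣ-↭ (prep A L↭) (skip s) = skip (InΣ-↭ L↭ s)
  InΣ-↭ (prep A L↭) (take a∈ s) = take a∈ (InΣ-↭ L↭ s)
  InΣ-↭ (swap A B L↭) (skip (skip s)) = skip (skip (InΣ-↭ L↭ s))
  InΣ-↭ (swap A B L↭) (skip (take b∈ s)) = take b∈ (skip (InΣ-↭ L↭ s))
  InΣ-↭ (swap A B L↭) (take a∈ (skip s)) = skip (take a∈ (InΣ-↭ L↭ s))
  InΣ-↭ (swap A B L↭) (take a∈ (take b∈ s)) = take₂ b∈ a∈ (InΣ-↭ L↭ s)
  InΣ-↭ (transitive L↭ L↭′) s = InΣ-↭ L↭′ (InΣ-↭ L↭ s)

  -- `sums` ranges over every `k`, because under a common first member a taken element lowers the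
  -- number of summands still to be chosen.
  record Shrinks (L L′ : List (Subset p)) : Set where
    field
      sums    : ∀ {k x} → InΣ k L′ x → InΣ k L x
      mult-≡  : ∀ x → mult L x ≡ mult L′ x
  open Shrinks

  Shrinks-↭ : ∀ {L L′} → L ↭ L′ → Shrinks L L′
  Shrinks-↭ L↭ .sums   = InΣ-↭ (↭-sym L↭)
  Shrinks-↭ L↭ .mult-≡ = mult-↭ L↭

  infixr 5 _then_

  _then_ : ∀ {L L′ L″} → Shrinks L L′ → Shrinks L′ L″ → Shrinks L L″
  (s then t) .sums     = s .sums ∘ t .sums
  (s then t) .mult-≡ x = trans (s .mult-≡ x) (t .mult-≡ x)

  under : ∀ A {L L′} → Shrinks L L′ → Shrinks (A ∷ L) (A ∷ L′)
  under A s .sums (skip t)    = skip (s .sums t)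
  under A s .sums (take a∈ t) = take a∈ (s .sums t)
  under A s .mult-≡ x         = cong (χ A x +_) (s .mult-≡ x)

  -- A summand from `A ∩ B` may stand for either set, so it takes whichever of `A` and `B` the
  -- summand from `A ∪ B` leaves free.
  uncross : ∀ A B L → Shrinks (A ∷ B ∷ L) ((A ∪ B) ∷ (A ∩ B) ∷ L)
  uncross A B L .mult-≡ x = begin
    χ A x + (χ B x + mult L x)              ≡⟨ +-assoc (χ A x) _ _ ⟨
    χ A x + χ B x + mult L x                ≡⟨ cong (_+ mult L x) (χ-∪∩ A B x) ⟨
    χ (A ∪ B) x + χ (A ∩ B) x + mult L x    ≡⟨ +-assoc (χ (A ∪ B) x) _ _ ⟩
    χ (A ∪ B) x + (χ (A ∩ B) x + mult L x)  ∎
    where open ≡-Reasoning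
  uncross A B L .sums (skip (skip s)) = skip (skip s)
  uncross A B L .sums (skip (take b∈ s)) = take (p∩q⊆p A B b∈) (skip s)
  uncross A B L .sums (take a∈ (skip s)) with x∈p∪q⁻ A B a∈
  ... | inj₁ a∈A = take a∈A (skip s)
  ... | inj₂ a∈B = skip (take a∈B s)
  uncross A B L .sums (take a∈ (take b∈ s)) with x∈p∪q⁻ A B a∈
  ... | inj₁ a∈A = take a∈A (take (p∩q⊆q A B b∈) s)
  ... | inj₂ a∈B = take₂ (p∩q⊆p A B b∈) a∈B s

  bubble-Shrinks : ∀ C L → Shrinks (C ∷ L) (meet C L ∷ bubble C L)
  bubble-Shrinks C []      = Shrinks-↭ refl
  bubble-Shrinks C (A ∷ L) = Shrinks-↭ (swap C A refl) then uncross A C L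
    then under (A ∪ C) (bubble-Shrinks (A ∩ C) L) then Shrinks-↭ (swap _ _ refl)

  module Families (ℓ : ℕ) (1≤ℓ : 1 ≤ ℓ) (S M U : Subset p) (μ₀ : Fin p → ℕ)
    (M-spec : ∀ x → x ∈ M ⇔ μ₀ x ≡ ℓ) (U-spec : ∀ x → x ∈ U ⇔ 1 ≤ μ₀ x) where
    open Equivalence using (to; from)

    -- The invariant of all reductions: `S` and the capped multiplicity `μ₀` belong to the original
    -- family and stay fixed while the list varies. Sums are only required to lie in `S`, as
    -- uncrossing may lose some.
    record Valid (L : List (Subset p)) : Set where
      field
        big   : All Big L
        sums⊆ : ∀ {x} → InΣ ℓ L x → x ∈ S
        mult≡ : ∀ x → ℓ ⊓ mult L x ≡ μ₀ x
    open Valid public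

    Valid-Shrinks : ∀ {L L′} → All Big L′ → Shrinks L L′ → Valid L → Valid L′
    Valid-Shrinks big′ s v = record
      { big = big′ ; sums⊆ = sums⊆ v ∘ s .sums
      ; mult≡ = λ x → trans (cong (ℓ ⊓_) (sym (s .mult-≡ x))) (mult≡ v x) }

    Valid-↭ : ∀ {L L′} → L ↭ L′ → Valid L → Valid L′
    Valid-↭ L↭ v = Valid-Shrinks (All-resp-↭ L↭ (big v)) (Shrinks-↭ L↭) v

    -- Skipping `D` can only lose sums. On `D` the other members already reach the cap `ℓ`, and off
    -- `D` the multiplicity does not change.
    Valid-drop : ∀ {L D L′} → Shrinks L (D ∷ L′) → (∀ {x} → x ∈ D → ℓ ≤ mult L′ x) →
      All Big L′ → Valid L → Valid L′
    Valid-drop {D = D} {L′} s drop big′ v = record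
      { big = big′ ; sums⊆ = sums⊆ v ∘ s .sums ∘ skip
      ; mult≡ = λ x → trans (same x) (trans (cong (ℓ ⊓_) (sym (s .mult-≡ x))) (mult≡ v x)) }
      where
      same : ∀ x → ℓ ⊓ mult L′ x ≡ ℓ ⊓ (χ D x + mult L′ x)
      same x with x ∈? D
      ... | yes x∈ = trans (m≤n⇒m⊓n≡m (drop x∈)) (sym (m≤n⇒m⊓n≡m (≤-trans (drop x∈) (m≤n+m _ (χ D x)))))
      ... | no  x∉ = cong (λ n → ℓ ⊓ (n + mult L′ x)) (sym (χ-∉ x∉))

    ℓ≤mult⇒∈M : ∀ {L x} → Valid L → ℓ ≤ mult L x → x ∈ M
    ℓ≤mult⇒∈M v ℓ≤ = from (M-spec _) (trans (sym (mult≡ v _)) (m≤n⇒m⊓n≡m ℓ≤))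

    ∈M⇒All : ∀ {L x} → Valid L → length L ≡ ℓ → x ∈ M → All (x ∈_) L
    ∈M⇒All {L} {x} v len x∈M = length≤mult⇒All-∈ L
      (≤-trans (≤-reflexive (trans len (trans (sym (to (M-spec x) x∈M)) (sym (mult≡ v x))))) (m⊓n≤n ℓ _))

    ∈member⇒∈U : ∀ {L B x} → Valid L → B ∈ₗ L → x ∈ B → x ∈ U
    ∈member⇒∈U v B∈ x∈ = from (U-spec _) (≤-trans (⊓-glb 1≤ℓ (∈⇒1≤mult B∈ x∈)) (≤-reflexive (mult≡ v _)))

    ∈U⇒∈member : ∀ {L x} → Valid L → x ∈ U → ∃ λ B → B ∈ₗ L × x ∈ B
    ∈U⇒∈member {L} {x} v x∈ = 1≤mult⇒∈ L (≤-trans (to (U-spec x) x∈) (≤-trans (≤-reflexive (sym (mult≡ v x))) (m⊓n≤n ℓ _)))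

    M⊆U : M ⊆ U
    M⊆U x∈ = from (U-spec _) (subst (1 ≤_) (sym (to (M-spec _) x∈)) 1≤ℓ)

    ∪-absorb : ∀ Y {I} → I ⊆ M → (Y ∪ I) ∪ M ≡ Y ∪ M
    ∪-absorb Y {I} I⊆M = ⊆-antisym l r
      where
      l : (Y ∪ I) ∪ M ⊆ Y ∪ M
      l x∈ with x∈p∪q⁻ (Y ∪ I) M x∈
      ... | inj₂ x∈M = x∈p∪q⁺ (inj₂ x∈M)
      ... | inj₁ x∈YI with x∈p∪q⁻ Y I x∈YI
      ...   | inj₁ x∈Y = x∈p∪q⁺ (inj₁ x∈Y)
      ...   | inj₂ x∈I = x∈p∪q⁺ (inj₂ (I⊆M x∈I))
      r : Y ∪ M ⊆ (Y ∪ I) ∪ M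
      r x∈ with x∈p∪q⁻ Y M x∈
      ... | inj₁ x∈Y = x∈p∪q⁺ (inj₁ (x∈p∪q⁺ (inj₁ x∈Y)))
      ... | inj₂ x∈M = x∈p∪q⁺ (inj₂ x∈M)

    -- With exactly `ℓ` members, a point of multiplicity at least `ℓ` lies in all of them, so `M` is
    -- contained in `Y ∪ I`.
    ∪-exact : ∀ {Y I L} → I ⊆ M → Valid L → length L ≡ ℓ → (Y ∪ I) ∈ₗ L → Y ∪ I ≡ Y ∪ M
    ∪-exact {Y} {I} I⊆M v len YI∈ = ⊆-antisym l r
      where
      l : Y ∪ I ⊆ Y ∪ M
      l x∈ with x∈p∪q⁻ Y I x∈
      ... | inj₁ x∈Y = x∈p∪q⁺ (inj₁ x∈Y)
      ... | inj₂ x∈I = x∈p∪q⁺ (inj₂ (I⊆M x∈I))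
      r : Y ∪ M ⊆ Y ∪ I
      r x∈ with x∈p∪q⁻ Y M x∈
      ... | inj₁ x∈Y = x∈p∪q⁺ (inj₁ x∈Y)
      ... | inj₂ x∈M = All.lookup (∈M⇒All v len x∈M) YI∈

    module _ {Y H L} (v : Valid (Y ∷ H ∷ L)) (ℓ≤ : ℓ ≤ suc (length L)) where
      private I = meet H L

      -- `Y` is visited last, so all it gains is `I`. The discarded `Y ∩ I` lies in each of the
      -- `1 + length L` sets that stay, and these are at least `ℓ`.
      reduce₁ : Valid ((Y ∪ I) ∷ bubble H L)
      reduce₁ = Valid-drop
        (under Y (bubble-Shrinks H L) then uncross Y I (bubble H L) then Shrinks-↭ (swap _ _ refl))
        (λ {x} x∈ → let x∈Y , x∈I = x∈p∩q⁻ Y I x∈ in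
          ≤-trans (subst (λ n → ℓ ≤ suc n) (sym (length-bubble H L)) ℓ≤)
            (All-∈⇒length≤mult {L = (Y ∪ I) ∷ bubble H L} (p⊆p∪q I x∈Y ∷ ∈-meet⇒All-bubble H L x∈I)))
        (Big-∪ Y I (All.head (big v)) ∷ Big-bubble H (All.tail (All.tail (big v)))) v

      meet⊆M : I ⊆ M
      meet⊆M {x} x∈ = ℓ≤mult⇒∈M v (≤-trans ℓ≤ (≤-trans (∈-meet⇒length≤mult H L x∈) (m≤n+m _ (χ Y x))))

    module _ {X Y H L} (v : Valid (X ∷ Y ∷ H ∷ L)) (ℓ≤ : ℓ ≤ 2 + length L) where
      private I = meet H L

      -- `X` and `Y` are visited last, in this order, while `H` meets the head of `L` first: the
      -- plain union of these two members appears in the result.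
      reduce₂ : Valid ((X ∪ I) ∷ (Y ∪ (X ∩ I)) ∷ bubble H L)
      reduce₂ = Valid-drop
        (under X (under Y (bubble-Shrinks H L) then Shrinks-↭ (swap _ _ refl))
          then uncross X I (Y ∷ bubble H L)
          then under (X ∪ I) (Shrinks-↭ (swap _ _ refl) then uncross Y (X ∩ I) (bubble H L) then Shrinks-↭ (swap _ _ refl))
          then Shrinks-↭ (swap _ _ refl))
        (λ {x} x∈ → let x∈Y , x∈XI = x∈p∩q⁻ Y (X ∩ I) x∈ ; x∈X , x∈I = x∈p∩q⁻ X I x∈XI in
          ≤-trans (subst (λ n → ℓ ≤ 2 + n) (sym (length-bubble H L)) ℓ≤)
            (All-∈⇒length≤mult {L = (X ∪ I) ∷ (Y ∪ (X ∩ I)) ∷ bubble H L}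
              (p⊆p∪q I x∈X ∷ p⊆p∪q (X ∩ I) x∈Y ∷ ∈-meet⇒All-bubble H L x∈I)))
        (Big-∪ X I (All.head (big v)) ∷ Big-∪ Y (X ∩ I) (All.head (All.tail (big v)))
          ∷ Big-bubble H (All.tail (All.tail (All.tail (big v))))) v

      ∩-meet⊆M : X ∩ I ⊆ M
      ∩-meet⊆M {x} x∈ = let x∈X , x∈I = x∈p∩q⁻ X I x∈ in
        ℓ≤mult⇒∈M (Valid-↭ (swap X Y refl) v) (≤-trans ℓ≤
          (≤-trans (All-∈⇒length≤mult {L = X ∷ H ∷ L} (x∈X ∷ meet⊆ H L x∈I ∷ ∈-meet⇒All H L x∈I)) (m≤n+m _ (χ Y x))))

    -- Before the last step `Y` grows only inside `M`, which `∪-absorb` hides; after the last step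
    -- exactly `ℓ` sets are left, and `∪-exact` shows that all of `M` has been gained.
    reduce : ∀ n {Y L} → length L ≡ n → Valid (Y ∷ L) → 2 ≤ ℓ → ℓ < suc n →
      ∃ λ L′ → Valid ((Y ∪ M) ∷ L′) × suc (length L′) ≡ ℓ
    reduce zero len v 2≤ℓ ℓ<1 = ⊥-elim (<⇒≱ ℓ<1 (<⇒≤ 2≤ℓ))
    reduce (suc n) {Y} {H ∷ L} len v 2≤ℓ ℓ<2+n with m≤n⇒m<n∨m≡n (≤-pred ℓ<2+n)
    ... | inj₂ ℓ≡1+n = bubble H L , subst (λ Z → Valid (Z ∷ bubble H L)) (∪-exact (meet⊆M v ℓ≤) v′ len′ (here refl)) v′ , len′
      where
      ℓ≤ : ℓ ≤ suc (length L)
      ℓ≤ = ≤-reflexive (trans ℓ≡1+n (sym len))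
      v′ = reduce₁ v ℓ≤
      len′ = trans (cong suc (length-bubble H L)) (trans len (sym ℓ≡1+n))
    ... | inj₁ ℓ<1+n =
      let ℓ≤ = subst (ℓ ≤_) (sym len) (<⇒≤ ℓ<1+n)
          L′ , v′ , len′ = reduce n (trans (length-bubble H L) (suc-injective len)) (reduce₁ v ℓ≤) 2≤ℓ ℓ<1+n
      in L′ , subst (λ Z → Valid (Z ∷ L′)) (∪-absorb Y (meet⊆M v ℓ≤)) v′ , len′

-- Double counting of sizes

∑-cong : ∀ {n} {f g : Fin n → ℕ} → (∀ i → f i ≡ g i) → ∑ f ≡ ∑ g
∑-cong {zero}  f≡g = refl
∑-cong {suc n} f≡g = cong₂ _+_ (f≡g zero) (∑-cong (f≡g ∘ suc))

∑-zero : ∀ n → ∑ {n} (λ _ → 0) ≡ 0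
∑-zero zero    = refl
∑-zero (suc n) = ∑-zero n

∑-+ : ∀ {n} (f g : Fin n → ℕ) → ∑ (λ i → f i + g i) ≡ ∑ f + ∑ g
∑-+ {zero}  f g = refl
∑-+ {suc n} f g = begin
  f zero + g zero + ∑ (λ i → f (suc i) + g (suc i))  ≡⟨ cong (f zero + g zero +_) (∑-+ (f ∘ suc) (g ∘ suc)) ⟩
  f zero + g zero + (∑ (f ∘ suc) + ∑ (g ∘ suc))      ≡⟨ +-interchange (f zero) (g zero) _ _ ⟩
  f zero + ∑ (f ∘ suc) + (g zero + ∑ (g ∘ suc))      ∎
  where
  open ≡-Reasoning
  open CommutativeSemigroupProperties +-commutativeSemigroup using () renaming (interchange to +-interchange)

∑χ : ∀ {n} (B : Subset n) → ∑ (χ B) ≡ ∣ B ∣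
∑χ []            = refl
∑χ (true ∷ B)  = cong suc (∑χ B)
∑χ (false ∷ B) = ∑χ B

∑-mult : ∀ {n} (L : List (Subset n)) → ∑ (mult L) ≡ size L
∑-mult {n} []  = ∑-zero n
∑-mult (B ∷ L) = trans (∑-+ (χ B) (mult L)) (cong₂ _+_ (∑χ B) (∑-mult L))

-- Families attaining the Cauchy-Davenport bound

module Extremal (p : ℕ) .{{_ : NonZero p}} (pr : Prime p) (ℓ : ℕ) (2≤ℓ : 2 ≤ ℓ) (S M U : Subset p) (μ₀ : Fin p → ℕ)
    (M-spec : ∀ x → x ∈ M ⇔ μ₀ x ≡ ℓ) (U-spec : ∀ x → x ∈ U ⇔ 1 ≤ μ₀ x) where
  open Uncrossing p pr public
  open Families ℓ (<⇒≤ 2≤ℓ) S M U μ₀ M-spec U-spec public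

  -- A list of `ℓ` sets has no multiplicity above `ℓ`, so the cap in `μ₀` is inactive.
  size≡∑ : ∀ {L} → Valid L → length L ≡ ℓ → size L ≡ ∑ μ₀
  size≡∑ {L} v len = trans (sym (∑-mult L)) (∑-cong λ x →
    trans (sym (m≥n⇒m⊓n≡n (subst (mult L x ≤_) len (mult≤length L x)))) (mult≡ v x))

  sumset⊆S : ∀ {L} → Valid L → length L ≡ ℓ → sumset L ⊆ S
  sumset⊆S {L} v len x∈ = sums⊆ v (subst (λ k → InΣ k L _) len (sumset⇒InΣ L x∈))

  module _ (S<p : ∣ S ∣ < p) (S-tight : ∣ S ∣ + ℓ ≤ suc (∑ μ₀)) where

    Valid⇒Critical : ∀ {L} → Valid L → length L ≡ ℓ → Critical L
    Valid⇒Critical {L} v len = record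
      { big = big v
      ; <p = ≤-<-trans ∣sumset∣≤ S<p
      ; tight = subst₂ (λ k s → ∣ sumset L ∣ + k ≤ suc s) (sym len) (sym (size≡∑ v len))
                  (≤-trans (+-monoˡ-≤ ℓ ∣sumset∣≤) S-tight) }
      where ∣sumset∣≤ = p⊆q⇒∣p∣≤∣q∣ (sumset⊆S v len)

    S⊆sumset : ∀ {L} → Valid L → length L ≡ ℓ → S ⊆ sumset L
    S⊆sumset {L} v len = ⊆∧∣∣≥⇒⊇ (sumset⊆S v len) (+-cancelʳ-≤ ℓ _ _ (begin
      ∣ S ∣ + ℓ                  ≤⟨ S-tight ⟩
      suc (∑ μ₀)                 ≡⟨ cong suc (size≡∑ v len) ⟨
      suc (size L)               ≤⟨ cauchyDavenport-list (big v) (≤-<-trans (p⊆q⇒∣p∣≤∣q∣ (sumset⊆S v len)) S<p) ⟩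
      ∣ sumset L ∣ + length L    ≡⟨ cong (∣ sumset L ∣ +_) len ⟩
      ∣ sumset L ∣ + ℓ           ∎))
      where open ≤-Reasoning

    Valid-AP : ∀ {L} → Valid L → length L ≡ ℓ → 2 + ∣ S ∣ ≤ p ⊎ 3 ≤ ℓ → ∃ λ d → toℕ d ≢ 0 × All (AP d) L
    Valid-AP {[]} v len _ = ⊥-elim (<⇒≱ 2≤ℓ (≤-trans (≤-reflexive (sym len)) z≤n))
    Valid-AP {_ ∷ []} v len _ = ⊥-elim (<⇒≱ 2≤ℓ (≤-reflexive (sym len)))
    Valid-AP {B ∷ C ∷ L} v len small =
      let crit = Valid⇒Critical v len
          d , d≢0 , apB = head-AP crit (small′ small)
      in d , d≢0 , AP-all d≢0 crit (here refl) apB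
      where
      small′ : 2 + ∣ S ∣ ≤ p ⊎ 3 ≤ ℓ → 2 + ∣ sumset (B ∷ C ∷ L) ∣ ≤ p ⊎ 1 ≤ length L
      small′ (inj₁ small) = inj₁ (≤-trans (s≤s (s≤s (p⊆q⇒∣p∣≤∣q∣ (sumset⊆S v len)))) small)
      small′ (inj₂ 3≤ℓ) = inj₂ (≤-pred (≤-pred (subst (3 ≤_) (sym len) 3≤ℓ)))

    module Common (3≤ℓ : 3 ≤ ℓ) {d : Fin p} (d≢0 : toℕ d ≢ 0) where

      -- From `ℓ + 1` sets, two unrelated unions end up in one critical list: `Y ∪ M`, because `Y`
      -- is visited last, and `K ∪ H`, because `K` is visited first. Either can then pass its
      -- difference to the other.
      exchange : ∀ {X Y H K L} → Valid (X ∷ Y ∷ H ∷ K ∷ L) → 3 + length L ≡ ℓ →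
        ∃ λ L′ → Valid L′ × length L′ ≡ ℓ × (Y ∪ M) ∈ₗ L′ × (K ∪ H) ∈ₗ L′
      exchange {X} {Y} {H} {K} {L} v len = L′ , v′ , len′
        , subst (_∈ₗ L′) (∪-exact (∩-meet⊆M v (≤-reflexive (sym len))) v′ len′ (there (here refl))) (there (here refl))
        , there (there (here refl))
        where
        L′ = (X ∪ meet H (K ∷ L)) ∷ (Y ∪ (X ∩ meet H (K ∷ L))) ∷ bubble H (K ∷ L)
        v′ : Valid L′
        v′ = reduce₂ v (≤-reflexive (sym len))
        len′ : length L′ ≡ ℓ
        len′ = trans (cong (2 +_) (length-bubble H (K ∷ L))) len

      exchange-AP : ∀ {X Y H K L} → Valid (X ∷ Y ∷ H ∷ K ∷ L) → 3 + length L ≡ ℓ → AP d (Y ∪ M) → AP d (K ∪ H)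
      exchange-AP v len apYM with L′ , v′ , len′ , YM∈ , KH∈ ← exchange v len =
        All.lookup (AP-all d≢0 (Valid⇒Critical v′ len′) YM∈ apYM) KH∈

      exchange-AP′ : ∀ {X Y H K L} → Valid (X ∷ Y ∷ H ∷ K ∷ L) → 3 + length L ≡ ℓ → AP d (K ∪ H) → AP d (Y ∪ M)
      exchange-AP′ v len apKH with L′ , v′ , len′ , YM∈ , KH∈ ← exchange v len =
        All.lookup (AP-all d≢0 (Valid⇒Critical v′ len′) KH∈ apKH) YM∈

      -- `K ∪ H` depends on neither `Y` nor `Z`, so it links the reduction ending with `Y` to the
      -- one ending with `Z`. Finding `H` and `K` besides them takes `ℓ + 1 ≥ 4` sets.
      ∪M-transfer : ∀ {Y Z L} → Valid (Y ∷ Z ∷ L) → suc (length L) ≡ ℓ → AP d (Y ∪ M) → AP d (Z ∪ M)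
      ∪M-transfer {L = []}    v len _ = ⊥-elim (<⇒≱ 2≤ℓ (≤-reflexive (sym len)))
      ∪M-transfer {L = _ ∷ []} v len _ = ⊥-elim (<⇒≱ 3≤ℓ (≤-reflexive (sym len)))
      ∪M-transfer {L = H ∷ K ∷ L} v len apY =
        exchange-AP′ v len (exchange-AP (Valid-↭ (swap _ _ refl) v) len apY)

      ∪M-all : ∀ {L B} → Valid L → length L ≡ suc ℓ → B ∈ₗ L → AP d (B ∪ M) → All (λ C → AP d (C ∪ M)) L
      ∪M-all {L} {B} v len B∈ apB with L′ , L↭ ← ∈-∃↭ B∈ =
        All-resp-↭ (↭-sym L↭) (apB ∷ All.tabulate λ C∈L′ →
          let L″ , L′↭ = ∈-∃↭ C∈L′
              L↭′ = ↭-trans L↭ (prep B L′↭)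
          in ∪M-transfer (Valid-↭ L↭′ v) (suc-injective (trans (sym (↭-length L↭′)) len)) apB)

      -- With `Z` uncrossed against `K` first and `Y` visited last, the known difference of `Y ∪ M`
      -- reaches the union.
      pair-AP : ∀ {K Z L} → Valid (K ∷ Z ∷ L) → suc (length L) ≡ ℓ → All (λ C → AP d (C ∪ M)) L → AP d (K ∪ Z)
      pair-AP {L = []} v len _ = ⊥-elim (<⇒≱ 2≤ℓ (≤-reflexive (sym len)))
      pair-AP {L = _ ∷ []} v len _ = ⊥-elim (<⇒≱ 3≤ℓ (≤-reflexive (sym len)))
      pair-AP {K} {Z} {X ∷ Y ∷ L} v len (_ ∷ apY ∷ _) =
        exchange-AP (Valid-↭ (↭-trans (swap K Z refl) (shifts (Z ∷ K ∷ []) (X ∷ Y ∷ []))) v) len apY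

      -- Two starts of U are starts of the union of at most two members, which is a progression.
      U-OneStart : ∀ {L} → Valid L → length L ≡ suc ℓ → All (λ C → AP d (C ∪ M)) L → OneStart d U
      U-OneStart {L} v len aps x y x∉ x+d∈ y∉ y+d∈
        with K , K∈ , x+d∈K ← ∈U⇒∈member v x+d∈ with Z , Z∈ , y+d∈Z ← ∈U⇒∈member v y+d∈
        with L′ , L↭ ← ∈-∃↭ K∈ with ∈-resp-↭ L↭ Z∈
      ... | here refl = AP⇒OneStart (All.lookup aps K∈) x y
              (x∉ ∘ ⊆U) (x∈p∪q⁺ (inj₁ x+d∈K)) (y∉ ∘ ⊆U) (x∈p∪q⁺ (inj₁ y+d∈Z))
        where
        ⊆U : K ∪ M ⊆ U
        ⊆U z∈ with x∈p∪q⁻ K M z∈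
        ... | inj₁ z∈K = ∈member⇒∈U v K∈ z∈K
        ... | inj₂ z∈M = M⊆U z∈M
      ... | there Z∈L′ with L″ , L′↭ ← ∈-∃↭ Z∈L′ = AP⇒OneStart apKZ x y
              (x∉ ∘ ⊆U) (x∈p∪q⁺ (inj₁ x+d∈K)) (y∉ ∘ ⊆U) (x∈p∪q⁺ (inj₂ y+d∈Z))
        where
        L↭′ = ↭-trans L↭ (prep K L′↭)
        apKZ = pair-AP (Valid-↭ L↭′ v) (suc-injective (trans (sym (↭-length L↭′)) len))
                 (All.tail (All.tail (All-resp-↭ L↭′ aps)))
        ⊆U : K ∪ Z ⊆ U
        ⊆U z∈ with x∈p∪q⁻ K Z z∈
        ... | inj₁ z∈K = ∈member⇒∈U v K∈ z∈K
        ... | inj₂ z∈Z = ∈member⇒∈U v Z∈ z∈Z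

      -- Reduction stops at `ℓ + 1` sets, where `exchange` applies. Until then the remainder `I`
      -- lies in `M`, so `X ∪ M` and `Y ∪ M` do not change although `X` and `Y` may grow.
      common-difference : ∀ n {X Y L} → length L ≡ n → Valid (X ∷ Y ∷ L) → ℓ < 2 + n →
        AP d (Y ∪ M) → AP d (X ∪ M) × AP d U
      common-difference n {X} {Y} {L} len v ℓ<2+n apY with m≤n⇒m<n∨m≡n (≤-pred ℓ<2+n)
      ... | inj₂ ℓ≡1+n = All.head aps , OneStart⇒AP d≢0 (U-OneStart v len′ aps)
              (let x , x∈ = Big⇒Nonempty (All.head (big v)) in x , ∈member⇒∈U v (here refl) x∈)
        where
        len′ : length (X ∷ Y ∷ L) ≡ suc ℓ
        len′ = cong suc (trans (cong suc len) (sym ℓ≡1+n))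
        aps = ∪M-all v len′ (there (here refl)) apY
      common-difference zero _ _ _ _ | inj₁ ℓ<1 = ⊥-elim (<⇒≱ ℓ<1 (<⇒≤ 2≤ℓ))
      common-difference (suc n) {X} {Y} {H ∷ L} len v _ apY | inj₁ ℓ<2+n =
        let I = meet H L
            len′ = suc-injective len
            ℓ≤ = subst (λ k → ℓ ≤ suc k) (sym len′) (≤-pred ℓ<2+n)
            I⊆M : I ⊆ M
            I⊆M {x} x∈ = ℓ≤mult⇒∈M v (≤-trans ℓ≤ (≤-trans (∈-meet⇒length≤mult H L x∈)
                            (≤-trans (m≤n+m _ (χ Y x)) (m≤n+m _ (χ X x)))))
            apX , apU = common-difference n (trans (length-bubble H L) len′) (reduce₂ v (m≤n⇒m≤1+n ℓ≤)) ℓ<2+n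
              (subst (AP d) (sym (∪-absorb Y (λ x∈ → I⊆M (p∩q⊆q X I x∈)))) apY)
        in subst (AP d) (∪-absorb X I⊆M) apX , apU

-- Translation to the stated definitions and conclusion

∑χ≡mult : ∀ {n m} (A : Fin m → Subset n) x → ∑ (λ j → χ (A j) x) ≡ mult (List.tabulate A) x
∑χ≡mult {m = zero}  A x = refl
∑χ≡mult {m = suc m} A x = cong (χ (A zero) x +_) (∑χ≡mult (A ∘ suc) x)

∈-⋃⁺ : ∀ {n} {L : List (Subset n)} {B x} → B ∈ₗ L → x ∈ B → x ∈ ⋃ L
∈-⋃⁺ (here refl) x∈ = x∈p∪q⁺ (inj₁ x∈)
∈-⋃⁺ (there B∈)  x∈ = x∈p∪q⁺ (inj₂ (∈-⋃⁺ B∈ x∈))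

∈-⋃⁻ : ∀ {n} (L : List (Subset n)) {x} → x ∈ ⋃ L → ∃ λ B → B ∈ₗ L × x ∈ B
∈-⋃⁻ [] x∈ = ⊥-elim (∉⊥ x∈)
∈-⋃⁻ (A ∷ L) x∈ with x∈p∪q⁻ A (⋃ L) x∈
... | inj₁ x∈A = A , here refl , x∈A
... | inj₂ x∈L with B , B∈ , x∈B ← ∈-⋃⁻ L x∈L = B , there B∈ , x∈B

tabulation : ∀ {A : Set} {n} (L : List A) → length L ≡ n → ∃ λ (f : Fin n → A) → List.tabulate f ≡ L
tabulation L refl = List.lookup L , tabulate-lookup L

module Final (p : ℕ) .{{_ : NonZero p}} (pr : Prime p) (ℓ m : ℕ) (2≤ℓ : 2 ≤ ℓ) (ℓ<m : ℓ < m)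
  (A : Fin m → Subset p) (bigA : ∀ i → 2 ≤ ∣ A i ∣)
  (S : Subset p) (S-spec : ∀ x → (x ∈ S) ⇔ InSumset p ℓ m A x) where

  open Equivalence using (to; from)

  private
    U M : Subset p
    U = unionA p m A
    M = Mset p m A ℓ
    μ₀ : Fin p → ℕ
    μ₀ = μ p m A ℓ
    1≤ℓ = <⇒≤ 2≤ℓ
    L = List.tabulate A

    μ₀≡ : ∀ x → ℓ ⊓ mult L x ≡ μ₀ x
    μ₀≡ x = cong (ℓ ⊓_) (sym (∑χ≡mult A x))

  U-spec : ∀ x → x ∈ U ⇔ 1 ≤ μ₀ x
  U-spec x = mk⇔
    (λ x∈ → let B , B∈ , x∈B = ∈-⋃⁻ L x∈ in subst (1 ≤_) (μ₀≡ x) (⊓-glb 1≤ℓ (∈⇒1≤mult B∈ x∈B)))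
    (λ 1≤ → let B , B∈ , x∈B = 1≤mult⇒∈ L (≤-trans 1≤ (subst (_≤ mult L x) (μ₀≡ x) (m⊓n≤n ℓ _))) in ∈-⋃⁺ B∈ x∈B)

  M-spec : ∀ x → x ∈ M ⇔ μ₀ x ≡ ℓ
  M-spec x = mk⇔
    (λ x∈ → ≡ᵇ⇒≡ _ _ (proj₂ (to T-∧ (from T-≡ (trans (sym (lookup∘tabulate _ x)) ([]=⇒lookup x∈))))))
    (λ e → lookup⇒[]= x M (trans (lookup∘tabulate _ x) (to T-≡ (from T-∧
      ( from T-≡ ([]=⇒lookup (from (U-spec x) (subst (1 ≤_) (sym e) 1≤ℓ))) , ≡⇒≡ᵇ (μ₀ x) ℓ e)))))

  open Extremal p pr ℓ 2≤ℓ S M U μ₀ M-spec U-spec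

  sumμ≡∑μ₀ : sumμ p m A ℓ ≡ ∑ μ₀
  sumμ≡∑μ₀ = ∑-cong pointwise
    where
    pointwise : ∀ x → (if lookup U x then μ₀ x else 0) ≡ μ₀ x
    pointwise x with lookup U x in eq
    ... | true  = refl
    ... | false = sym (n≤0⇒n≡0 (≮⇒≥ λ 1≤ → contradiction (trans (sym eq) ([]=⇒lookup (from (U-spec x) 1≤))) (λ ())))

  InΣ⇒InSumset : ∀ {k m x} (A : Fin m → Subset p) → InΣ k (List.tabulate A) x → InSumset p k m A x
  InΣ⇒InSumset {m = zero}  A done = (λ ()) , (λ ()) , (λ ()) , (λ ()) , refl
  InΣ⇒InSumset {m = suc m} A (skip s) with f , f-mono , g , g∈ , e ← InΣ⇒InSumset (A ∘ suc) s =
    suc ∘ f , (λ i j i<j → s≤s (f-mono i j i<j)) , g , g∈ , e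
  InΣ⇒InSumset {m = suc m} A (take {a = a} a∈ s) with f , f-mono , g , g∈ , e ← InΣ⇒InSumset (A ∘ suc) s =
    f′ , f′-mono , g′ , g′∈ , cong (a ⊞_) e
    where
    f′ : Fin (suc _) → Fin (suc m)
    f′ zero    = zero
    f′ (suc j) = suc (f j)
    f′-mono : ∀ i j → i <ᶠ j → f′ i <ᶠ f′ j
    f′-mono zero    (suc j) _         = s≤s z≤n
    f′-mono (suc i) (suc j) (s≤s i<j) = s≤s (f-mono i j i<j)
    g′ : Fin (suc _) → Fin p
    g′ zero    = a
    g′ (suc j) = g j
    g′∈ : ∀ j → g′ j ∈ A (f′ j)
    g′∈ zero    = a∈
    g′∈ (suc j) = g∈ j

  InSum⇒∈sumset : ∀ {n x} (B : Fin n → Subset p) → InSum p n B x → x ∈ sumset (List.tabulate B)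
  InSum⇒∈sumset {zero}  B (g , g∈ , refl) = x∈⁅x⁆ 0ₚ
  InSum⇒∈sumset {suc n} B (g , g∈ , refl) = ∈-⊕⁺ (g∈ zero) (InSum⇒∈sumset (B ∘ suc) (g ∘ suc , g∈ ∘ suc , refl))

  ∈sumset⇒InSum : ∀ {n x} (B : Fin n → Subset p) → x ∈ sumset (List.tabulate B) → InSum p n B x
  ∈sumset⇒InSum {zero}  B x∈ = (λ ()) , (λ ()) , sym (x∈⁅y⁆⇒x≡y 0ₚ x∈)
  ∈sumset⇒InSum {suc n} B x∈ with b , y , b∈ , y∈ , refl ← ∈-⊕⁻ x∈ with g , g∈ , e ← ∈sumset⇒InSum (B ∘ suc) y∈ =
    g′ , g′∈ , cong (b ⊞_) e
    where
    g′ : Fin (suc n) → Fin p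
    g′ zero    = b
    g′ (suc j) = g j
    g′∈ : ∀ j → g′ j ∈ B j
    g′∈ zero    = b∈
    g′∈ (suc j) = g∈ j

  length≤size : ∀ {L : List (Subset p)} → All Big L → length L ≤ size L
  length≤size []       = z≤n
  length≤size (b ∷ bs) = +-mono-≤ (<⇒≤ b) (length≤size bs)

  valid : Valid L
  valid = record
    { big = All-tabulate⁺ bigA ; sums⊆ = λ {x} s → from (S-spec x) (InΣ⇒InSumset A s) ; mult≡ = μ₀≡ }

  len : length L ≡ m
  len = length-tabulate A

  bring : ∀ i → ∃ λ L′ → L ↭ A i ∷ L′ × suc (length L′) ≡ m
  bring i = let L′ , L↭ = ∈-∃↭ (∈-tabulate⁺ i) in L′ , L↭ , trans (sym (↭-length L↭)) len

  reduced : ∀ i → ∃ λ L′ → Valid ((A i ∪ M) ∷ L′) × length ((A i ∪ M) ∷ L′) ≡ ℓ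
  reduced i = let L′ , L↭ , len′ = bring i in
    reduce (length L′) refl (Valid-↭ L↭ valid) 2≤ℓ (subst (ℓ <_) (sym len′) ℓ<m)

  0ᵐ : Fin m
  0ᵐ = fromℕ< (≤-<-trans z≤n ℓ<m)

  module _ (eq : ∣ S ∣ ≡ sumμ p m A ℓ ∸ ℓ + 1) (S<p : ∣ S ∣ < p) where

    S-tight : ∣ S ∣ + ℓ ≤ suc (∑ μ₀)
    S-tight = ≤-reflexive (begin
      ∣ S ∣ + ℓ                 ≡⟨ cong (_+ ℓ) (trans eq (+-comm _ 1)) ⟩
      suc (sumμ p m A ℓ ∸ ℓ + ℓ) ≡⟨ cong (λ s → suc (s ∸ ℓ + ℓ)) sumμ≡∑μ₀ ⟩
      suc (∑ μ₀ ∸ ℓ + ℓ)         ≡⟨ cong suc (m∸n+n≡m ℓ≤∑) ⟩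
      suc (∑ μ₀)                ∎)
      where
      open ≡-Reasoning
      -- Subtraction is truncated, so this must be known: a reduced family has `ℓ` nonempty sets and
      -- total size `∑ μ₀`.
      ℓ≤∑ : ℓ ≤ ∑ μ₀
      ℓ≤∑ = let L′ , v , len = reduced 0ᵐ in subst₂ _≤_ len (size≡∑ v len) (length≤size (big v))

    minimizing-tabulation : ∀ {d} (B : Fin ℓ → Subset p) → Valid (List.tabulate B) → toℕ d ≢ 0 →
      All (AP d) (List.tabulate B) → IsMinimizingWith p ℓ m A d
    minimizing-tabulation B v d≢0 aps = d≢0 , B
      , (λ i x x∈ → ∈member⇒∈U v (∈-tabulate⁺ i) x∈)
      , All-tabulate⁻ (big v)
      , All-tabulate⁻ aps
      , (λ a _ → begin
          μ₀ a                         ≡⟨ mult≡ v a ⟨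
          ℓ ⊓ mult (List.tabulate B) a ≡⟨ m≥n⇒m⊓n≡n (subst (mult (List.tabulate B) a ≤_) lenB (mult≤length (List.tabulate B) a)) ⟩
          mult (List.tabulate B) a     ≡⟨ ∑χ≡mult B a ⟨
          ∑ (λ j → χ (B j) a)          ∎)
      , λ x → mk⇔ (to (S-spec x) ∘ sumset⊆S v lenB ∘ InSum⇒∈sumset B)
                  (∈sumset⇒InSum B ∘ S⊆sumset S<p S-tight v lenB ∘ from (S-spec x))
      where
      open ≡-Reasoning
      lenB = length-tabulate B

    minimizing : 2 + ∣ S ∣ ≤ p ⊎ 3 ≤ ℓ → IsMinimizing p ℓ m A
    minimizing small =
      let L′ , v , len = reduced 0ᵐ
          d , d≢0 , aps = Valid-AP S<p S-tight v len small
          B , B≡ = tabulation _ len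
      in d , minimizing-tabulation B (subst Valid (sym B≡) v) d≢0 (subst (All (AP d)) (sym B≡) aps)

    members-AP : 2 + ∣ S ∣ ≤ p ⊎ 3 ≤ ℓ → ∀ i → ∃ λ d → toℕ d ≢ 0 × AP d (A i ∪ M)
    members-AP small i = let L′ , v , len = reduced i
                             d , d≢0 , aps = Valid-AP S<p S-tight v len small in d , d≢0 , All.head aps

    common-AP : 3 ≤ ℓ → ∃ λ d → toℕ d ≢ 0 × AP d U × (∀ i → AP d (A i ∪ M))
    common-AP 3≤ℓ with d , d≢0 , ap₀ ← members-AP (inj₂ 3≤ℓ) 0ᵐ with L₀ , L↭ , len₀ ← bring 0ᵐ =
      d , d≢0 , proj₂ (both (proj₂ (some L₀ len₀))) , λ i → at (∈-resp-↭ L↭ (∈-tabulate⁺ i))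
      where
      open Common S<p S-tight 3≤ℓ d≢0
      both : ∀ {B} → B ∈ₗ L₀ → AP d (B ∪ M) × AP d U
      both B∈ = let L″ , L₀↭ = ∈-∃↭ B∈
                    -- The two sets visited last in every reduction are `B` and, as bearer of the
                    -- known difference, `A 0ᵐ`.
                    L↭′ = ↭-trans L↭ (↭-trans (prep _ L₀↭) (swap _ _ refl))
                in common-difference (length L″) refl (Valid-↭ L↭′ valid)
                     (subst (ℓ <_) (trans (sym len) (↭-length L↭′)) ℓ<m) ap₀
      at : ∀ {B} → B ∈ₗ A 0ᵐ ∷ L₀ → AP d (B ∪ M)
      at (here refl) = ap₀
      at (there B∈)  = proj₁ (both B∈)
      some : ∀ L′ → suc (length L′) ≡ m → ∃ (_∈ₗ L′)
      some []      len₁ = ⊥-elim (<⇒≱ ℓ<m (≤-trans (≤-reflexive (sym len₁)) 1≤ℓ))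
      some (B ∷ _) _    = B , here refl

  module _ (S<p : ∣ S ∣ < p) {d : Fin p} (min : IsMinimizingWith p ℓ m A d) where
    private
      d≢0 = proj₁ min
      B = proj₁ (proj₂ min)
      props = proj₂ (proj₂ min)
      B⊆U = proj₁ props
      bigB = proj₁ (proj₂ props)
      apB = proj₁ (proj₂ (proj₂ props))
      μ≡ = proj₁ (proj₂ (proj₂ (proj₂ props)))
      sums = proj₂ (proj₂ (proj₂ (proj₂ props)))

    sumset≡S : sumset (List.tabulate B) ≡ S
    sumset≡S = ⊆-antisym (λ {x} x∈ → from (S-spec x) (to (sums x) (∈sumset⇒InSum B x∈)))
                         (λ {x} x∈ → InSum⇒∈sumset B (from (sums x) (to (S-spec x) x∈)))

    sumμ≡size : sumμ p m A ℓ ≡ size (List.tabulate B)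
    sumμ≡size = trans sumμ≡∑μ₀ (trans (∑-cong pointwise) (∑-mult (List.tabulate B)))
      where
      pointwise : ∀ x → μ₀ x ≡ mult (List.tabulate B) x
      pointwise x with x ∈? U
      ... | yes x∈ = trans (μ≡ x x∈) (∑χ≡mult B x)
      ... | no  x∉ = trans (n≤0⇒n≡0 (≮⇒≥ (x∉ ∘ from (U-spec x)))) (sym (n≤0⇒n≡0 (≮⇒≥ λ 1≤ →
          let C , C∈ , x∈C = 1≤mult⇒∈ (List.tabulate B) 1≤ in x∉ (All.lookup {P = _⊆ U} (All-tabulate⁺ (λ i → B⊆U i _)) C∈ x∈C))))

    -- Offsets add, and a term of `B i` has offset at most `∣ B i ∣ - 1`; `t + n ≤ size` is the sum
    -- of these bounds, written without subtraction.
    AP-sums : ∀ {n} (B : Fin n → Subset p) → (∀ i → AP d (B i)) →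
      ∃ λ a → ∀ {x} → x ∈ sumset (List.tabulate B) → ∃ λ t → t + n ≤ size (List.tabulate B) × x ≡ el a d t
    AP-sums {zero} B ap = 0ₚ , λ x∈ → 0 , z≤n , trans (x∈⁅y⁆⇒x≡y 0ₚ x∈) (sym (el-zero 0ₚ d))
    AP-sums {suc n} B ap with a , iff ← AP-normalise d≢0 (ap zero) with b , rest ← AP-sums (B ∘ suc) (ap ∘ suc) =
      a ⊞ b , mem
      where
      mem : ∀ {x} → x ∈ sumset (List.tabulate B) → ∃ λ t → t + suc n ≤ size (List.tabulate B) × x ≡ el (a ⊞ b) d t
      mem x∈ with y , z , y∈ , z∈ , refl ← ∈-⊕⁻ x∈ with i , i< , refl ← to (iff y) y∈ with t , t≤ , refl ← rest z∈ =
        i + t , ≤-trans (≤-reflexive rearrange) (+-mono-≤ i< t≤) , el-⊞ a b d i t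
        where
        rearrange : i + t + suc n ≡ suc i + (t + n)
        rearrange = trans (+-suc (i + t) n) (cong suc (+-assoc i t n))

    -- The common difference confines the sum to a progression of `sumμ p m A ℓ ∸ ℓ + 1` terms;
    -- Cauchy-Davenport, available since `∣ S ∣ < p`, gives the reverse inequality.
    minimizing⇒tight : ∣ S ∣ ≡ sumμ p m A ℓ ∸ ℓ + 1
    minimizing⇒tight = ≤-antisym upper (+-cancelʳ-≤ ℓ _ _ lower)
      where
      s = size (List.tabulate B)
      bigs : All Big (List.tabulate B)
      bigs = All-tabulate⁺ bigB
      ℓ≤s : ℓ ≤ s
      ℓ≤s = subst (_≤ s) (length-tabulate B) (length≤size bigs)
      open ≤-Reasoning
      upper : ∣ S ∣ ≤ sumμ p m A ℓ ∸ ℓ + 1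
      upper = let a , mem = AP-sums B apB in ∣AP∣≤k a d _ S λ {x} x∈ →
        let t , t≤ , x≡ = mem (subst (x ∈_) (sym sumset≡S) x∈)
        in t , subst (t <_) (sym (+-comm _ 1)) (s≤s (m+n≤o⇒m≤o∸n t (subst (t + ℓ ≤_) (sym sumμ≡size) t≤))) , x≡
      lower : sumμ p m A ℓ ∸ ℓ + 1 + ℓ ≤ ∣ S ∣ + ℓ
      lower = begin
        sumμ p m A ℓ ∸ ℓ + 1 + ℓ                                     ≡⟨ cong (λ n → n ∸ ℓ + 1 + ℓ) sumμ≡size ⟩
        s ∸ ℓ + 1 + ℓ                                                ≡⟨ cong (_+ ℓ) (+-comm (s ∸ ℓ) 1) ⟩
        suc (s ∸ ℓ + ℓ)                                              ≡⟨ cong suc (m∸n+n≡m ℓ≤s) ⟩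
        suc s                                                        ≤⟨ cauchyDavenport-list bigs (subst (λ T → ∣ T ∣ < p) (sym sumset≡S) S<p) ⟩
        ∣ sumset (List.tabulate B) ∣ + length (List.tabulate B)      ≡⟨ cong₂ (λ T k → ∣ T ∣ + k) sumset≡S (length-tabulate B) ⟩
        ∣ S ∣ + ℓ                                                    ∎

theorem4p2 : (p : ℕ) .{{_ : NonZero p}} → Prime p →
    (ℓ m : ℕ) → 2 ≤ ℓ → ℓ < m →
    (A : Fin m → Subset p) → (∀ i → 2 ≤ ∣ A i ∣) →
    (S : Subset p) → (∀ x → (x ∈ S) ⇔ InSumset p ℓ m A x) →
    (ℓ ≡ 2 → ∣ S ∣ < p ∸ 1) →
    (3 ≤ ℓ → ∣ S ∣ < p) →
    ((∣ S ∣ ≡ sumμ p m A ℓ ∸ ℓ + 1) ⇔ IsMinimizing p ℓ m A)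
    × (∣ S ∣ ≡ sumμ p m A ℓ ∸ ℓ + 1 →
    (ℓ ≡ 2 → ∀ i → IsAP p (A i ∪ Mset p m A ℓ))
    × (3 ≤ ℓ → ∃ λ (d : Fin p) → (toℕ d ≢ 0)
    × IsAPWith p d (unionA p m A)
    × (∀ i → IsAPWith p d (A i ∪ Mset p m A ℓ))))
theorem4p2 p pr ℓ m 2≤ℓ ℓ<m A bigA S S-spec <p-1 <p =
    mk⇔ (λ eq → minimizing eq S<p small) (λ (d , min) → minimizing⇒tight S<p min)
  , λ eq → (λ _ i → members-AP eq S<p small i) , common-AP eq S<p
  where
  open Final p pr ℓ m 2≤ℓ ℓ<m A bigA S S-spec
  -- For `ℓ = 2`, being strictly below `p ∸ 1` leaves two residues outside `S`, as Vosper's theorem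
  -- requires.
  small : 2 + ∣ S ∣ ≤ p ⊎ 3 ≤ ℓ
  small with m≤n⇒m<n∨m≡n 2≤ℓ
  ... | inj₁ 3≤ℓ = inj₂ 3≤ℓ
  ... | inj₂ 2≡ℓ = inj₁ (subst (2 + ∣ S ∣ ≤_) (suc-pred p) (s≤s (<p-1 (sym 2≡ℓ))))
  S<p : ∣ S ∣ < p
  S<p with small
  ... | inj₁ 2+S≤p = <⇒≤ 2+S≤p
  ... | inj₂ 3≤ℓ = <p 3≤ℓ
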